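{- For every positive integer $n$, $$\widetilde{B}^+_n(t) = \sum_{i=0}^{\lfloor n/2 \rfloor} \widetilde{\gamma}^+_{n,2,i}\, t^i (1+t)^{n-2i}, \qquad \widetilde{B}^-_n(t) = \sum_{i=1}^{\lfloor (n+1)/2 \rfloor} \widetilde{\gamma}^-_{n,2,i}\, t^i (1+t)^{n+1-2i},$$ where (i) $\widetilde{\gamma}^+_{n,2,i}$ is equal to the number of signed permutations $w \in \mathbb{Z}_2 \wr \mathfrak{S}_n$ for which $\mathrm{Des}_B(w)$ is a set of $i$ elements, no two consecutive, and does not contain $n$; (ii) $\widetilde{\gamma}^-_{n,2,i}$ is equal to the number of signed permutations $w \in \mathbb{Z}_2 \wr \mathfrak{S}_n$ for which $\mathrm{Des}_B(w)$ is a set of $i$ elements, no two consecutive, and contains $n$.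
   Context: **Type $B$ binomial Eulerian polynomials.** Elements of $\mathbb{Z}_2 \wr \mathfrak{S}_n$ can be represented as pairs $(\sigma,\varepsilon)$ with $\sigma\in\mathfrak{S}_n$, $\varepsilon\in\{0,1\}^n$. An index $k\in\{1,\dots,n\}$ is a descent if $\varepsilon_k > \varepsilon_{k+1}$, or $\varepsilon_k=\varepsilon_{k+1}$ and $\sigma(k)>\sigma(k+1)$, where $\sigma(n+1):=n+1$, $\varepsilon_{n+1}:=0$; $\mathrm{des}$ is the number of descents. Let $B_n(t) = \sum_{w\in\mathbb{Z}_2\wr\mathfrak{S}_n} t^{\mathrm{des}(w)}$, $B_0(t)=1$, and $\widetilde{B}_n(t) = \sum_{m=0}^n \binom{n}{m} t^{n-m} B_m(t)$. The polynomials $\widetilde{B}^+_n(t)$ and $\widetilde{B}^-_n(t)$ are the unique polynomials with $\widetilde{B}_n(t) = \widetilde{B}^+_n(t)+\widetilde{B}^-_n(t)$ such that $\widetilde{B}^+_n(t)$ is palindromic with center $n/2$ (i.e. $t^n\widetilde{B}^+_n(1/t) = \widetilde{B}^+_n(t)$) and $\widetilde{B}^-_n(t)$ is palindromic with center $(n+1)/2$ (i.e. $t^{n+1}\widetilde{B}^-_n(1/t) = \widetilde{B}^-_n(t)$). **The set $\mathrm{Des}_B$.** Here a signed permutation $w\in\mathbb{Z}_2\wr\mathfrak{S}_n$ is written as a sequence $(w(1),\dots,w(n))$ of nonzero integers such that $(|w(1)|,\dots,|w(n)|)$ is a permutation of $\{1,\dots,n\}$. $\mathrm{Des}_B(w)$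 is the set of indices $i\in\{1,\dots,n\}$ for which either $w(i)$ is positive and $w(i)>w(i+1)$, or else both $w(i)$ and $w(i+1)$ are negative and $|w(i)|>|w(i+1)|$, where $w(n+1):=0$. -}

module Defs where

open import Algebra.Bundles.Raw using (RawSemiring)
import Algebra.Definitions.RawSemiring as RawSemiringDefinitions
open import Data.Bool.Base using (Bool; true; false; if_then_else_)
import Data.Bool as Bool
open import Data.Fin.Base using (Fin; toℕ; inject₁) renaming (suc to fsuc)
import Data.Fin.Properties as Fin
open import Data.Fin.Subset using (Subset; ∣_∣; _∈_)
open import Data.Fin.Subset.Properties using (_∈?_; ∣p∣≤n)
open import Data.Integer.Base as ℤ using (ℤ; +_; -[1+_]; 0ℤ; 1ℤ)
import Data.Integer.Properties as ℤ
open import Data.Integer.Tactic.RingSolver using (solve-∀)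
open import Data.List.Base as List
  using (List; []; _∷_; map; foldr; length; filter; allFin; applyUpTo; cartesianProduct; cartesianProductWith)
open import Data.Nat.Base as ℕ using (ℕ; zero; suc; _∸_; s≤s; z≤n)
open import Data.Nat.Combinatorics using (_C_)
import Data.Nat.Properties as ℕ
open import Data.Product.Base using (∃; ∃₂; _×_; _,_; proj₁; proj₂)
open import Data.Sum.Base using (_⊎_)
open import Data.Vec.Base as Vec using (Vec; lookup; _∷ʳ_; tabulate)
import Data.Vec.Relation.Unary.AllPairs as AllPairs
open import Data.Vec.Relation.Unary.Unique.Propositional using (Unique)
open import Function.Base using (_∘_)
open import Level using (0ℓ)
open import Relation.Binary.PropositionalEquality
  using (_≡_; refl; sym; trans; cong; cong₂; subst; module ≡-Reasoning)
open import Relation.Nullary using (¬_; Dec; yes; no; does; contradiction)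
open import Relation.Nullary.Decidable using (_×-dec_; _⊎-dec_; _→-dec_; ¬?)

-- Coefficient lists, constant term first.  Trailing zeros are allowed,
-- so equality of polynomials is _≈_ and not _≡_.
Poly : Set
Poly = List ℤ

coeff : Poly → ℕ → ℤ
coeff []      _       = 0ℤ
coeff (a ∷ p) zero    = a
coeff (a ∷ p) (suc k) = coeff p k

-- The coefficient of t^k for any integer k, as for Laurent polynomials.
coeffᶻ : Poly → ℤ → ℤ
coeffᶻ p (+ k)    = coeff p k
coeffᶻ p -[1+ _ ] = 0ℤ

infix  4 _≈_
infixl 6 _+_
infixl 7 _*_

_≈_ : Poly → Poly → Set
p ≈ q = ∀ k → coeff p k ≡ coeff q k

_+_ : Poly → Poly → Poly
[]      + q       = q
(a ∷ p) + []      = a ∷ p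
(a ∷ p) + (b ∷ q) = (a ℤ.+ b) ∷ (p + q)

_*_ : Poly → Poly → Poly
[]      * q = []
(a ∷ p) * q = map (a ℤ.*_) q + (0ℤ ∷ p * q)

0ᴾ 1ᴾ t : Poly
0ᴾ = []
1ᴾ = 1ℤ ∷ []
t  = 0ℤ ∷ 1ℤ ∷ []

polyRawSemiring : RawSemiring 0ℓ 0ℓ
polyRawSemiring = record
  { Carrier = Poly ; _≈_ = _≈_ ; _+_ = _+_ ; _*_ = _*_ ; 0# = 0ᴾ ; 1# = 1ᴾ }

open RawSemiringDefinitions polyRawSemiring public
  using (_^_) renaming (_×_ to _·_)

infixr 5 ∑

∑ : {A : Set} → List A → (A → Poly) → Poly
∑ xs f = foldr _+_ 0ᴾ (map f xs)

syntax ∑ xs (λ x → p) = ∑[ x ∈ xs ] p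

-- The integers a, a + 1, …, b (none if b < a).
[_⋯_] : ℕ → ℕ → List ℕ
[ a ⋯ b ] = applyUpTo (a ℕ.+_) (suc b ∸ a)

words : {A : Set} → List A → ∀ n → List (Vec A n)
words xs zero    = Vec.[] ∷ []
words xs (suc n) = cartesianProductWith Vec._∷_ xs (words xs n)

unique? : ∀ {m n} (σ : Vec (Fin m) n) → Dec (Unique σ)
unique? = AllPairs.allPairs? (λ i j → ¬? (i Fin.≟ j))

permutations : ∀ n → List (Vec (Fin n) n)
permutations n = filter unique? (words (allFin n) n)

-- A pair (σ , ε), with ε_k = 1 encoded as true.  The letters of σ are
-- shifted down by one: lookup σ i stands for σ(i+1) - 1.
SignedWord : ℕ → Set
SignedWord n = Vec (Fin n) n × Vec Bool n

-- The elements of ℤ₂ ≀ 𝔖ₙ, each listed once.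
signedPermutations : ∀ n → List (SignedWord n)
signedPermutations n = cartesianProduct (permutations n) (words (false ∷ true ∷ []) n)

-- Subsets of {1,…,n} are encoded as Subset n, with k represented by the
-- element k - 1 of Fin n.  Position k of a word extended by its (n+1)-st
-- letter is then inject₁ of this element, and position k + 1 is fsuc of it.

module _ {n : ℕ} (w : SignedWord n) where

  private
    σ : Fin (suc n) → ℕ
    σ = lookup (Vec.map (suc ∘ toℕ) (proj₁ w) ∷ʳ suc n)

    ε : Fin (suc n) → Bool
    ε = lookup (proj₂ w ∷ʳ false)

  IsDescent : Fin n → Set
  IsDescent k =
      ε (fsuc k) Bool.< ε (inject₁ k)
    ⊎ (ε (inject₁ k) ≡ ε (fsuc k) × σ (fsuc k) ℕ.< σ (inject₁ k))

  isDescent? : ∀ k → Dec (IsDescent k)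
  isDescent? k =
      (ε (fsuc k) Bool.<? ε (inject₁ k))
    ⊎-dec ((ε (inject₁ k) Bool.≟ ε (fsuc k)) ×-dec (σ (fsuc k) ℕ.<? σ (inject₁ k)))

  des : ℕ
  des = ∣ tabulate (does ∘ isDescent?) ∣

-- The sequence (w(1),…,w(n)) of nonzero integers: w(k) is σ(k) if ε_k = 0
-- and -σ(k) if ε_k = 1.
entries : ∀ {n} → SignedWord n → Vec ℤ n
entries (σ , ε) = Vec.zipWith (λ s e → if e then -[1+ toℕ s ] else + suc (toℕ s)) σ ε

module _ {n : ℕ} (w : SignedWord n) where

  private
    ŵ : Fin (suc n) → ℤ
    ŵ = lookup (entries w ∷ʳ 0ℤ)

  IsDescentB : Fin n → Set
  IsDescentB i =
      (0ℤ ℤ.< ŵ (inject₁ i) × ŵ (fsuc i) ℤ.< ŵ (inject₁ i))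
    ⊎ ((ŵ (inject₁ i) ℤ.< 0ℤ × ŵ (fsuc i) ℤ.< 0ℤ)
       × ℤ.∣ ŵ (fsuc i) ∣ ℕ.< ℤ.∣ ŵ (inject₁ i) ∣)

  isDescentB? : ∀ i → Dec (IsDescentB i)
  isDescentB? i =
      ((0ℤ ℤ.<? ŵ (inject₁ i)) ×-dec (ŵ (fsuc i) ℤ.<? ŵ (inject₁ i)))
    ⊎-dec (((ŵ (inject₁ i) ℤ.<? 0ℤ) ×-dec (ŵ (fsuc i) ℤ.<? 0ℤ))
           ×-dec (ℤ.∣ ŵ (fsuc i) ∣ ℕ.<? ℤ.∣ ŵ (inject₁ i) ∣))

  DesB : Subset n
  DesB = tabulate (does ∘ isDescentB?)

module _ {n : ℕ} (S : Subset n) where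

  NoConsecutive : Set
  NoConsecutive = ∀ i j → toℕ j ≡ suc (toℕ i) → ¬ (i ∈ S × j ∈ S)

  noConsecutive? : Dec NoConsecutive
  noConsecutive? = Fin.all? λ i → Fin.all? λ j →
    (toℕ j ℕ.≟ suc (toℕ i)) →-dec ¬? ((i ∈? S) ×-dec (j ∈? S))

  -- n ∈ S, viewing S as a subset of {1,…,n}.
  ContainsLast : Set
  ContainsLast = ∃ λ i → suc (toℕ i) ≡ n × i ∈ S

  containsLast? : Dec ContainsLast
  containsLast? = Fin.any? λ i → (suc (toℕ i) ℕ.≟ n) ×-dec (i ∈? S)

γ̃⁺ : ℕ → ℕ → ℕ
γ̃⁺ n i = length (filter
  (λ w → (∣ DesB w ∣ ℕ.≟ i) ×-dec noConsecutive? (DesB w) ×-dec ¬? (containsLast? (DesB w)))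
  (signedPermutations n))

γ̃⁻ : ℕ → ℕ → ℕ
γ̃⁻ n i = length (filter
  (λ w → (∣ DesB w ∣ ℕ.≟ i) ×-dec noConsecutive? (DesB w) ×-dec containsLast? (DesB w))
  (signedPermutations n))

B : ℕ → Poly
B n = ∑[ w ∈ signedPermutations n ] t ^ des w

B̃ : ℕ → Poly
B̃ n = ∑[ m ∈ [ 0 ⋯ n ] ] (n C m) · (t ^ (n ∸ m) * B m)

-- t^d p(1/t) = p(t), compared coefficientwise as Laurent polynomials;
-- the center of symmetry is d/2.
Palindromic : ℕ → Poly → Set
Palindromic d p = ∀ k → coeffᶻ p (+ d ℤ.- k) ≡ coeffᶻ p k

record IsSymmetricDecomposition (n : ℕ) (f p q : Poly) : Set where
  field
    sum≈         : f ≈ p + q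
    palindromic⁺ : Palindromic n p
    palindromic⁻ : Palindromic (suc n) q

coeff-+ : ∀ p q k → coeff (p + q) k ≡ coeff p k ℤ.+ coeff q k
coeff-+ []      q       k       = sym (ℤ.+-identityˡ _)
coeff-+ (a ∷ p) []      k       = sym (ℤ.+-identityʳ _)
coeff-+ (a ∷ p) (b ∷ q) zero    = refl
coeff-+ (a ∷ p) (b ∷ q) (suc k) = coeff-+ p q k

coeff-≥length : ∀ p {k} → length p ℕ.≤ k → coeff p k ≡ 0ℤ
coeff-≥length []      _       = refl
coeff-≥length (a ∷ p) (s≤s l) = coeff-≥length p l

palindromic : ∀ d p →
  (∀ i j → i ℕ.+ j ≡ d → coeff p i ≡ coeff p j) →
  (∀ i → d ℕ.< i → coeff p i ≡ 0ℤ) →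
  Palindromic d p
palindromic d p symm vanish (+ i) with i ℕ.≤? d
... | yes i≤d rewrite ℤ.m-n≡m⊖n d i | ℤ.⊖-≥ i≤d = symm (d ∸ i) i (ℕ.m∸n+n≡m i≤d)
... | no  i≰d rewrite ℤ.m-n≡m⊖n d i | ℤ.⊖-< (ℕ.≰⇒> i≰d) = lemma (i ∸ d) (ℕ.m<n⇒0<n∸m (ℕ.≰⇒> i≰d))
  where
  lemma : ∀ m → 0 ℕ.< m → coeffᶻ p (ℤ.- (+ m)) ≡ coeff p i
  lemma (suc m) _ = sym (vanish i (ℕ.≰⇒> i≰d))
palindromic d p symm vanish -[1+ i ] = vanish (d ℕ.+ suc i) (ℕ.m<m+n d (s≤s z≤n))

coeff-applyUpTo-< : ∀ f n {k} → k ℕ.< n → coeff (applyUpTo f n) k ≡ f k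
coeff-applyUpTo-< f (suc n) {zero}  _       = refl
coeff-applyUpTo-< f (suc n) {suc k} (s≤s l) = coeff-applyUpTo-< (f ∘ suc) n l

coeff-applyUpTo-≥ : ∀ f n {k} → n ℕ.≤ k → coeff (applyUpTo f n) k ≡ 0ℤ
coeff-applyUpTo-≥ f zero    _       = refl
coeff-applyUpTo-≥ f (suc n) (s≤s l) = coeff-applyUpTo-≥ (f ∘ suc) n l

private
  reflect : ∀ {i j d} → i ℕ.+ j ≡ d → d ∸ i ≡ j
  reflect {i} {j} refl = ℕ.m+n∸m≡n i j

-- With A k the sum of the first k coefficients of f, the decomposition is
-- p_k = A (k+1) + A (n+1-k) - A (n+1),  q_k = A (n+1) - A k - A (n+1-k).
symmetricDecomposition : ∀ n f → length f ℕ.≤ suc n →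
  ∃₂ λ p q → IsSymmetricDecomposition n f p q
symmetricDecomposition n f deg = p , q , record
  { sum≈         = sum≈
  ; palindromic⁺ = palindromic n p symm⁺ (λ i l → coeff-applyUpTo-≥ a (suc n) l)
  ; palindromic⁻ = palindromic (suc n) q symm⁻ (λ i l → coeff-applyUpTo-≥ b (suc (suc n)) l)
  }
  where
  A : ℕ → ℤ
  A zero    = 0ℤ
  A (suc k) = A k ℤ.+ coeff f k

  a b : ℕ → ℤ
  a k = A (suc k) ℤ.+ A (suc n ∸ k) ℤ.- A (suc n)
  b k = A (suc n) ℤ.- A k ℤ.- A (suc n ∸ k)

  p q : Poly
  p = applyUpTo a (suc n)
  q = applyUpTo b (suc (suc n))

  reflect′ : ∀ {i j} → i ℕ.+ j ≡ n → suc n ∸ i ≡ suc j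
  reflect′ {i} {j} e = reflect {i} (trans (ℕ.+-suc i j) (cong suc e))

  symm⁺ : ∀ i j → i ℕ.+ j ≡ n → coeff p i ≡ coeff p j
  symm⁺ i j e = begin
    coeff p i                               ≡⟨ coeff-applyUpTo-< a (suc n) (s≤s (subst (i ℕ.≤_) e (ℕ.m≤m+n i j))) ⟩
    A (suc i) ℤ.+ A (suc n ∸ i) ℤ.- A (suc n) ≡⟨ cong (λ x → A (suc i) ℤ.+ A x ℤ.- A (suc n)) (reflect′ {i} e) ⟩
    A (suc i) ℤ.+ A (suc j) ℤ.- A (suc n)     ≡⟨ cong (ℤ._- A (suc n)) (ℤ.+-comm (A (suc i)) (A (suc j))) ⟩
    A (suc j) ℤ.+ A (suc i) ℤ.- A (suc n)     ≡⟨ cong (λ x → A (suc j) ℤ.+ A x ℤ.- A (suc n)) (reflect′ {j} e′) ⟨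
    A (suc j) ℤ.+ A (suc n ∸ j) ℤ.- A (suc n) ≡⟨ coeff-applyUpTo-< a (suc n) (s≤s (subst (j ℕ.≤_) e′ (ℕ.m≤m+n j i))) ⟨
    coeff p j                               ∎
    where
    open ≡-Reasoning
    e′ : j ℕ.+ i ≡ n
    e′ = trans (ℕ.+-comm j i) e

  symm⁻ : ∀ i j → i ℕ.+ j ≡ suc n → coeff q i ≡ coeff q j
  symm⁻ i j e = begin
    coeff q i                               ≡⟨ coeff-applyUpTo-< b (suc (suc n)) (s≤s (subst (i ℕ.≤_) e (ℕ.m≤m+n i j))) ⟩
    A (suc n) ℤ.- A i ℤ.- A (suc n ∸ i)     ≡⟨ cong (λ x → A (suc n) ℤ.- A i ℤ.- A x) (reflect {i} e) ⟩
    A (suc n) ℤ.- A i ℤ.- A j               ≡⟨ swap (A (suc n)) (A i) (A j) ⟩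
    A (suc n) ℤ.- A j ℤ.- A i               ≡⟨ cong (λ x → A (suc n) ℤ.- A j ℤ.- A x) (reflect {j} e′) ⟨
    A (suc n) ℤ.- A j ℤ.- A (suc n ∸ j)     ≡⟨ coeff-applyUpTo-< b (suc (suc n)) (s≤s (subst (j ℕ.≤_) e′ (ℕ.m≤m+n j i))) ⟨
    coeff q j                               ∎
    where
    open ≡-Reasoning
    e′ : j ℕ.+ i ≡ suc n
    e′ = trans (ℕ.+-comm j i) e
    swap : ∀ x y z → x ℤ.- y ℤ.- z ≡ x ℤ.- z ℤ.- y
    swap = solve-∀

  a+b : ∀ k → coeff f k ≡ a k ℤ.+ b k
  a+b k = identity (coeff f k) (A k) (A (suc n ∸ k)) (A (suc n))
    where
    identity : ∀ c x y z → c ≡ x ℤ.+ c ℤ.+ y ℤ.- z ℤ.+ (z ℤ.- x ℤ.- y)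
    identity = solve-∀

  b-last : b (suc n) ≡ 0ℤ
  b-last rewrite ℕ.n∸n≡0 n = identity (A (suc n))
    where
    identity : ∀ x → x ℤ.- x ℤ.- 0ℤ ≡ 0ℤ
    identity = solve-∀

  coeff-q-> : ∀ k → suc n ℕ.≤ k → coeff q k ≡ 0ℤ
  coeff-q-> k n<k with k ℕ.≟ suc n
  ... | yes refl = trans (coeff-applyUpTo-< b (suc (suc n)) ℕ.≤-refl) b-last
  ... | no  k≢   = coeff-applyUpTo-≥ b (suc (suc n)) (ℕ.≤∧≢⇒< n<k (k≢ ∘ sym))

  sum≈ : f ≈ p + q
  sum≈ k with k ℕ.<? suc n
  ... | yes l = trans (a+b k) (sym (trans (coeff-+ p q k)
    (cong₂ ℤ._+_ (coeff-applyUpTo-< a (suc n) l) (coeff-applyUpTo-< b (suc (suc n)) (ℕ.m<n⇒m<1+n l)))))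
  ... | no ≮  = trans (coeff-≥length f (ℕ.≤-trans deg n<k)) (sym (trans (coeff-+ p q k)
    (cong₂ ℤ._+_ (coeff-applyUpTo-≥ a (suc n) n<k) (coeff-q-> k n<k))))
    where
    n<k : suc n ℕ.≤ k
    n<k = ℕ.≮⇒≥ ≮

module _ {n : ℕ} {f p q p′ q′ : Poly}
         (D : IsSymmetricDecomposition n f p q) (D′ : IsSymmetricDecomposition n f p′ q′) where

  private
    module D  = IsSymmetricDecomposition D
    module D′ = IsSymmetricDecomposition D′

    sumᶻ : ∀ {p q} → f ≈ p + q → ∀ k → coeffᶻ f k ≡ coeffᶻ p k ℤ.+ coeffᶻ q k
    sumᶻ {p} {q} e (+ k)    = trans (e k) (coeff-+ p q k)
    sumᶻ         e -[1+ k ] = refl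

    move : ∀ {x y z} → x ≡ y ℤ.+ z → y ≡ x ℤ.- z
    move {y = y} {z} refl = identity y z
      where
      identity : ∀ y z → y ≡ y ℤ.+ z ℤ.- z
      identity = solve-∀

    q⇒p : ∀ k → coeffᶻ q k ≡ coeffᶻ q′ k → coeffᶻ p k ≡ coeffᶻ p′ k
    q⇒p k e = trans (move (sumᶻ {p} {q} D.sum≈ k))
      (trans (cong (λ x → coeffᶻ f k ℤ.- x) e) (sym (move (sumᶻ {p′} {q′} D′.sum≈ k))))

    p⇒q : ∀ k → coeffᶻ p k ≡ coeffᶻ p′ k → coeffᶻ q k ≡ coeffᶻ q′ k
    p⇒q k e = trans (move (trans (sumᶻ {p} {q} D.sum≈ k) (ℤ.+-comm (coeffᶻ p k) (coeffᶻ q k))))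
      (trans (cong (λ x → coeffᶻ f k ℤ.- x) e)
      (sym (move (trans (sumᶻ {p′} {q′} D′.sum≈ k) (ℤ.+-comm (coeffᶻ p′ k) (coeffᶻ q′ k))))))

    -- q_{k+1} = q_{n-k} and p_{n-k} = p_k.
    step : ∀ k → coeffᶻ p k ≡ coeffᶻ p′ k → coeffᶻ q (ℤ.suc k) ≡ coeffᶻ q′ (ℤ.suc k)
    step k e = trans (sym (reflect-q q D.palindromic⁻))
      (trans (p⇒q (+ n ℤ.- k) (trans (D.palindromic⁺ k) (trans e (sym (D′.palindromic⁺ k)))))
             (reflect-q q′ D′.palindromic⁻))
      where
      identity : ∀ m k → (1ℤ ℤ.+ m) ℤ.- (1ℤ ℤ.+ k) ≡ m ℤ.- k
      identity = solve-∀
      reflect-q : ∀ r → Palindromic (suc n) r → coeffᶻ r (+ n ℤ.- k) ≡ coeffᶻ r (ℤ.suc k)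
      reflect-q r pal = trans (cong (coeffᶻ r) (sym (identity (+ n) k))) (pal (ℤ.suc k))

    unique⁻ : ∀ k → coeff q k ≡ coeff q′ k
    unique⁻ zero    = step -[1+ 0 ] refl
    unique⁻ (suc k) = step (+ k) (q⇒p (+ k) (unique⁻ k))

  symmetricDecomposition-unique : p ≈ p′ × q ≈ q′
  symmetricDecomposition-unique = (λ k → q⇒p (+ k) (unique⁻ k)) , unique⁻

length-+ : ∀ {m} p q → length p ℕ.≤ m → length q ℕ.≤ m → length (p + q) ℕ.≤ m
length-+ []      q       _        l        = l
length-+ (a ∷ p) []      l        _        = l
length-+ (a ∷ p) (b ∷ q) (s≤s l) (s≤s l′) = s≤s (length-+ p q l l′)

length-map : ∀ (f : ℤ → ℤ) p → length (map f p) ≡ length p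
length-map f []      = refl
length-map f (a ∷ p) = cong suc (length-map f p)

length-* : ∀ {a b} p q → length p ℕ.≤ suc a → length q ℕ.≤ suc b → length (p * q) ℕ.≤ suc (a ℕ.+ b)
length-* []      q _ _ = z≤n
length-* {a} {b} (x ∷ p) q (s≤s l) l′ = length-+ (map (x ℤ.*_) q) (0ℤ ∷ p * q)
  (subst (ℕ._≤ suc (a ℕ.+ b)) (sym (length-map _ q)) (ℕ.≤-trans l′ (s≤s (ℕ.m≤n+m b a))))
  (s≤s (tail a p l))
  where
  tail : ∀ a p → length p ℕ.≤ a → length (p * q) ℕ.≤ a ℕ.+ b
  tail zero    [] _ = z≤n
  tail (suc a) p  l = length-* {a} p q l l′

length-∑ : ∀ {A : Set} {m} (xs : List A) f → (∀ x → length (f x) ℕ.≤ m) → length (∑ xs f) ℕ.≤ m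
length-∑ []       f l = z≤n
length-∑ (x ∷ xs) f l = length-+ (f x) _ (l x) (length-∑ xs f l)

length-· : ∀ {m} k p → length p ℕ.≤ m → length (k · p) ℕ.≤ m
length-· zero    p l = z≤n
length-· (suc k) p l = length-+ p (k · p) l (length-· k p l)

length-t^ : ∀ k → length (t ^ k) ℕ.≤ suc k
length-t^ zero    = ℕ.≤-refl
length-t^ (suc k) = length-* {1} t (t ^ k) ℕ.≤-refl (length-t^ k)

length-B : ∀ n → length (B n) ℕ.≤ suc n
length-B n = length-∑ (signedPermutations n) _ λ w →
  ℕ.≤-trans (length-t^ (des w)) (s≤s (∣p∣≤n (tabulate (does ∘ isDescent? w))))

length-∑-applyUpTo : ∀ {m} (g : ℕ → ℕ) k f → (∀ i → i ℕ.< k → length (f (g i)) ℕ.≤ m) →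
  length (∑ (applyUpTo g k) f) ℕ.≤ m
length-∑-applyUpTo g zero    f l = z≤n
length-∑-applyUpTo g (suc k) f l = length-+ (f (g 0)) _ (l 0 (s≤s z≤n))
  (length-∑-applyUpTo (g ∘ suc) k f (λ i i<k → l (suc i) (s≤s i<k)))

length-B̃ : ∀ n → length (B̃ n) ℕ.≤ suc n
length-B̃ n = length-∑-applyUpTo (0 ℕ.+_) (suc n) (λ m → (n C m) · summand m) λ { m (s≤s m≤n) →
  length-· (n C m) (summand m) (subst (λ d → length (summand m) ℕ.≤ suc d) (ℕ.m∸n+n≡m m≤n)
    (length-* {n ∸ m} (t ^ (n ∸ m)) (B m) (length-t^ (n ∸ m)) (length-B m))) }
  where
  summand : ℕ → Poly
  summand m = t ^ (n ∸ m) * B m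

B̃-decomposition : ∀ n → ∃₂ λ p q → IsSymmetricDecomposition n (B̃ n) p q
B̃-decomposition n = symmetricDecomposition n (B̃ n) (length-B̃ n)

-- The decomposition chosen is the only one, by symmetricDecomposition-unique.
B̃⁺ B̃⁻ : ℕ → Poly
B̃⁺ n = proj₁ (B̃-decomposition n)
B̃⁻ n = proj₁ (proj₂ (B̃-decomposition n))

{-# OPTIONS --safe #-}

-- Up to flipping all signs, DesB is the descent set counted by des: the letters are
-- totally ordered, and the word is followed by an end letter that is larger than the
-- letters of one sign ("small") and smaller than those of the other.  In B̃ the
-- factor t^(n-m) accounts for n - m small letters written in decreasing order after
-- the end letter.  Cut a word at its smallest letter x as l x r.  If x is small, then
-- l contributes as if it were followed by -∞, and if moreover l is empty, then x can
-- either stay in front (weight 1) or be moved behind the end letter (weight t).  The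
-- γ-weights satisfy the same recursion, where 1 + t is the weight of the double ascent
-- x, so both sums agree for every choice of signs.  (For words followed by -∞ the case
-- of empty l is paired with that of empty r.)  The two γ-sums are palindromic, hence
-- they are the two parts of B̃.

module Submission where

import Algebra.Definitions.RawSemiring as RawSemiringDefinitions
import Algebra.Properties.CommutativeMonoid.Mult as CommutativeMonoidMult
import Algebra.Properties.CommutativeSemigroup as CommutativeSemigroupProperties
import Algebra.Properties.Monoid.Mult as MonoidMult
open import Algebra.Bundles using (CommutativeSemiring)
open import Algebra.Structures.Biased using (isCommutativeMonoidˡ; isCommutativeSemiringˡ)
import Data.Bool as Bool
open import Data.Bool.Base using (Bool; true; false; if_then_else_; not; _∧_)
import Data.Bool.Properties as Bool
open import Data.Fin.Base as Fin using (Fin; toℕ; inject₁) renaming (suc to fsuc)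
import Data.Fin.Properties as Fin
open import Data.Fin.Subset using (Subset; ∣_∣; _∈_)
import Data.Integer.Base as ℤ
import Data.Integer.Properties as ℤ
open import Data.Integer.Tactic.RingSolver using (solve-∀)
open import Data.List.Base
  using (List; []; _∷_; _++_; map; concatMap; foldr; null; length; lookup; filter; applyUpTo; upTo; allFin; cartesianProductWith)
open import Data.List.Membership.Propositional.Properties using (∈-lookup)
open import Data.List.Properties
  using (++-assoc; map-++; map-upTo; map-tabulate; tabulate-lookup; length-tabulate; applyUpTo-∷ʳ; filter-all; filter-accept; filter-reject)
open import Data.List.Relation.Binary.Permutation.Propositional
  using (_↭_; refl; prep; swap; trans; ↭-trans; ↭-prep; ↭-sym)
import Data.List.Relation.Binary.Permutation.Propositional.Properties as Perm
open import Data.List.Relation.Binary.Sublist.Propositional using (_⊆_; []; _∷_; _∷ʳ_; ⊆-refl)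
import Data.List.Relation.Binary.Sublist.Propositional.Properties as Sublist
open import Data.List.Relation.Unary.All as All using (All; []; _∷_)
import Data.List.Relation.Unary.All.Properties as All
open import Data.List.Relation.Unary.AllPairs as AllPairs using (AllPairs; []; _∷_)
import Data.List.Relation.Unary.AllPairs.Properties as AllPairs
open import Data.Nat.Base as ℕ using (ℕ; zero; suc; NonZero; ⌊_/2⌋; _∸_; _<ᵇ_; s≤s; z≤n)
open import Data.Nat.Combinatorics using (_C_; nCk+nC[k+1]≡[n+1]C[k+1]; k>n⇒nCk≡0)
import Data.Nat.Properties as ℕ
open import Data.Product.Base using (_×_; _,_; proj₁; proj₂; map₁; map₂; ∃₂)
open import Data.Vec.Base as Vec using (Vec; []; _∷_; toList; here; there)
import Data.Vec.Relation.Unary.All as VecAll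
open import Function.Base using (_∘_; const; id)
open import Level using (0ℓ)
open import Relation.Binary.PropositionalEquality as ≡ using (_≡_; _≢_; module ≡-Reasoning)
import Relation.Binary.Reasoning.Setoid as SetoidReasoning
open import Relation.Binary.Structures using (IsEquivalence)
open import Relation.Nullary using (Dec; does; yes; no; ¬_)
open import Relation.Nullary.Decidable using (¬?; _×-dec_; _⊎-dec_; dec-true; dec-false)

-- The γ-side signs all n letters, whereas a summand t^(n-m) B_m of B̃ signs only m of them. The gap
-- is closed by signing the removed letters too and demanding that they be small, which leaves a
-- single choice. Both sides then are sums over all sign assignments and agree assignment by
-- assignment, without any cancellation between different ones. The recursion at the smallest letter
-- m produces words over arbitrary subsets of the letters, so everything is stated for the
-- rearrangements of a list and not for permutations of an initial segment. For small m it reads F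
-- (m ∷ X) = (∑ over splits (L , R) of X of E L * F R) + t * F X, where E is the sum for words
-- before -∞ and does not depend on which letters are small. It involves addition and multiplication
-- only, so the weights live in an arbitrary commutative semiring with an element t. Polynomials
-- enter only at the end, where palindromicity separates the two γ-sums.

private variable
  A A′ A″ : Set

-- Splitting, cutting, arranging and signing the letters of a word

splits : List A → List (List A × List A)
splits []       = ([] , []) ∷ []
splits (x ∷ xs) = concatMap (λ (L , R) → (x ∷ L , R) ∷ (L , x ∷ R) ∷ []) (splits xs)

cuts : List A → List (List A × List A)
cuts []      = ([] , []) ∷ []
cuts (x ∷ w) = ([] , x ∷ w) ∷ map (map₁ (x ∷_)) (cuts w)

picks : List A → List (A × List A)
picks []       = []
picks (x ∷ xs) = (x , xs) ∷ map (map₂ (x ∷_)) (picks xs)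

insertions : A → List A → List (List A)
insertions x w = map (λ (l , r) → l ++ x ∷ r) (cuts w)

-- Built by inserting the head anywhere, and not by choosing a first letter: this isolates one given
-- letter, as the recursion at the smallest letter requires.
arrangements : List A → List (List A)
arrangements []       = [] ∷ []
arrangements (x ∷ xs) = concatMap (insertions x) (arrangements xs)

signings : List A → List (List (Bool × A))
signings []       = [] ∷ []
signings (x ∷ xs) = concatMap (λ v → ((false , x) ∷ v) ∷ ((true , x) ∷ v) ∷ []) (signings xs)

splits-⊆ : (X : List A) → All (λ (L , R) → L ⊆ X × R ⊆ X) (splits X)
splits-⊆ []       = ([] , []) ∷ []
splits-⊆ (x ∷ X) = All.concat⁺ (All.map⁺ (All.map
  (λ (l , r) → (≡.refl ∷ l , x ∷ʳ r) ∷ (x ∷ʳ l , ≡.refl ∷ r) ∷ []) (splits-⊆ X)))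

cuts-++ : (w : List A) → All (λ (l , r) → l ++ r ≡ w) (cuts w)
cuts-++ []      = ≡.refl ∷ []
cuts-++ (x ∷ w) = ≡.refl ∷ All.map⁺ (All.map (≡.cong (x ∷_)) (cuts-++ w))

arrangements-↭ : (X : List A) → All (_↭ X) (arrangements X)
arrangements-↭ []      = refl ∷ []
arrangements-↭ (x ∷ X) = All.concat⁺ (All.map⁺ (All.map
  (λ w↭X → All.map⁺ (All.map (λ { {l , r} ≡.refl → ↭-trans (Perm.shift x l r) (↭-prep x w↭X) }) (cuts-++ _)))
  (arrangements-↭ X)))

AllPairs-resp-⊆ : ∀ {R : A → A → Set} {xs ys} → xs ⊆ ys → AllPairs R ys → AllPairs R xs
AllPairs-resp-⊆ []          []       = []
AllPairs-resp-⊆ (_ ∷ʳ s)    (_ ∷ rs) = AllPairs-resp-⊆ s rs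
AllPairs-resp-⊆ (≡.refl ∷ s) (r ∷ rs) = Sublist.All-resp-⊆ s r ∷ AllPairs-resp-⊆ s rs

-- Sums over splits, cuts, arrangements and signings

module Sums (R : CommutativeSemiring 0ℓ 0ℓ) where

  open CommutativeSemiring R renaming (Carrier to K; refl to ≈-refl; sym to ≈-sym; trans to ≈-trans)
  open RawSemiringDefinitions rawSemiring using () renaming (_×_ to _·_)
  open SetoidReasoning setoid
  private
    module + = CommutativeSemigroupProperties +-commutativeSemigroup
    module · where
      open MonoidMult +-monoid public
      open CommutativeMonoidMult +-commutativeMonoid public using (×-distrib-+)

  ∑ : List A → (A → K) → K
  ∑ xs f = foldr _+_ 0# (map f xs)

  infixr 5 ∑
  syntax ∑ xs (λ x → e) = ∑[ x ∈ xs ] e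

  ∑-congᴬ : ∀ {xs : List A} {f g} → All (λ x → f x ≈ g x) xs → ∑ xs f ≈ ∑ xs g
  ∑-congᴬ []       = ≈-refl
  ∑-congᴬ (e ∷ es) = +-cong e (∑-congᴬ es)

  ∑-cong : ∀ (xs : List A) {f g} → (∀ x → f x ≈ g x) → ∑ xs f ≈ ∑ xs g
  ∑-cong xs e = ∑-congᴬ (All.universal e xs)

  ∑-++ : ∀ (xs ys : List A) f → ∑ (xs ++ ys) f ≈ ∑ xs f + ∑ ys f
  ∑-++ []       ys f = ≈-sym (+-identityˡ _)
  ∑-++ (x ∷ xs) ys f = ≈-trans (+-congˡ (∑-++ xs ys f)) (≈-sym (+-assoc _ _ _))

  ∑-map : ∀ (h : A → A′) xs f → ∑ (map h xs) f ≡ ∑ xs (f ∘ h)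
  ∑-map h []       f = ≡.refl
  ∑-map h (x ∷ xs) f = ≡.cong (f (h x) +_) (∑-map h xs f)

  ∑-concatMap : ∀ (h : A → List A′) xs f → ∑ (concatMap h xs) f ≈ ∑[ x ∈ xs ] ∑ (h x) f
  ∑-concatMap h []       f = ≈-refl
  ∑-concatMap h (x ∷ xs) f = ≈-trans (∑-++ (h x) (concatMap h xs) f) (+-congˡ (∑-concatMap h xs f))

  ∑-+ : ∀ (xs : List A) (f g : A → K) → ∑[ x ∈ xs ] (f x + g x) ≈ ∑ xs f + ∑ xs g
  ∑-+ []       f g = ≈-sym (+-identityˡ _)
  ∑-+ (x ∷ xs) f g = ≈-trans (+-congˡ (∑-+ xs f g)) (+.interchange _ _ _ _)

  ∑-0 : ∀ (xs : List A) → ∑[ x ∈ xs ] 0# ≈ 0#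
  ∑-0 []       = ≈-refl
  ∑-0 (x ∷ xs) = ≈-trans (+-identityˡ _) (∑-0 xs)

  ∑-*ˡ : ∀ a (xs : List A) (f : A → K) → ∑[ x ∈ xs ] (a * f x) ≈ a * ∑ xs f
  ∑-*ˡ a []       f = ≈-sym (zeroʳ a)
  ∑-*ˡ a (x ∷ xs) f = ≈-trans (+-congˡ (∑-*ˡ a xs f)) (≈-sym (distribˡ a _ _))

  ∑-*ʳ : ∀ a (xs : List A) (f : A → K) → ∑[ x ∈ xs ] (f x * a) ≈ ∑ xs f * a
  ∑-*ʳ a []       f = ≈-sym (zeroˡ a)
  ∑-*ʳ a (x ∷ xs) f = ≈-trans (+-congˡ (∑-*ʳ a xs f)) (≈-sym (distribʳ a _ _))

  ∑-swap : ∀ (xs : List A) (ys : List A′) (f : A → A′ → K) →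
    ∑[ x ∈ xs ] ∑[ y ∈ ys ] f x y ≈ ∑[ y ∈ ys ] ∑[ x ∈ xs ] f x y
  ∑-swap []       ys f = ≈-sym (∑-0 ys)
  ∑-swap (x ∷ xs) ys f = ≈-trans (+-congˡ (∑-swap xs ys f)) (≈-sym (∑-+ ys _ _))

  ∑-× : ∀ (xs : List A) (ys : List A′) (f : A → K) (g : A′ → K) →
    ∑[ x ∈ xs ] ∑[ y ∈ ys ] (f x * g y) ≈ ∑ xs f * ∑ ys g
  ∑-× xs ys f g = ≈-trans (∑-cong xs (λ x → ∑-*ˡ (f x) ys g)) (∑-*ʳ _ xs f)

  ∑-splits-∷ : ∀ x (X : List A) k →
    ∑ (splits (x ∷ X)) k ≈ ∑[ (L , R) ∈ splits X ] (k (x ∷ L , R) + k (L , x ∷ R))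
  ∑-splits-∷ x X k = ≈-trans (∑-concatMap _ (splits X) k) (∑-cong (splits X) λ _ → +-congˡ (+-identityʳ _))

  ∑-signings-∷ : ∀ x (X : List A) f →
    ∑ (signings (x ∷ X)) f ≈ ∑[ v ∈ signings X ] (f ((false , x) ∷ v) + f ((true , x) ∷ v))
  ∑-signings-∷ x X f = ≈-trans (∑-concatMap _ (signings X) f) (∑-cong (signings X) λ _ → +-congˡ (+-identityʳ _))

  ∑-cuts-∷ : ∀ x (w : List A) k →
    ∑ (cuts (x ∷ w)) k ≡ k ([] , x ∷ w) + (∑[ (l , r) ∈ cuts w ] k (x ∷ l , r))
  ∑-cuts-∷ x w k = ≡.cong (k ([] , x ∷ w) +_) (∑-map (map₁ (x ∷_)) (cuts w) k)

  ∑-picks-∷ : ∀ x (X : List A) k →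
    ∑ (picks (x ∷ X)) k ≡ k (x , X) + (∑[ (y , Y) ∈ picks X ] k (y , x ∷ Y))
  ∑-picks-∷ x X k = ≡.cong (k (x , X) +_) (∑-map (map₂ (x ∷_)) (picks X) k)

  ∑-arrangements-∷ : ∀ x (X : List A) f →
    ∑ (arrangements (x ∷ X)) f ≈ ∑[ w ∈ arrangements X ] ∑[ (l , r) ∈ cuts w ] f (l ++ x ∷ r)
  ∑-arrangements-∷ x X f = ≈-trans (∑-concatMap _ (arrangements X) f)
    (∑-cong (arrangements X) λ w → reflexive (∑-map _ (cuts w) f))

  ∑-splits-cong : ∀ (X : List A) {k k′} → (∀ {L R} → L ⊆ X → R ⊆ X → k (L , R) ≈ k′ (L , R)) →
    ∑ (splits X) k ≈ ∑ (splits X) k′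
  ∑-splits-cong X e = ∑-congᴬ (All.map (λ (l , r) → e l r) (splits-⊆ X))

  ∑-arrangements-cong : ∀ (X : List A) {f g} → (∀ {w} → w ↭ X → f w ≈ g w) →
    ∑ (arrangements X) f ≈ ∑ (arrangements X) g
  ∑-arrangements-cong X e = ∑-congᴬ (All.map e (arrangements-↭ X))

  ∑-splits-[]ˡ : ∀ (X : List A) (h : List A → K) →
    ∑[ (L , R) ∈ splits X ] (if null L then h R else 0#) ≈ h X
  ∑-splits-[]ˡ []      h = +-identityʳ _
  ∑-splits-[]ˡ (x ∷ X) h = ≈-trans (∑-splits-∷ x X _)
    (≈-trans (∑-cong (splits X) λ _ → +-identityˡ _) (∑-splits-[]ˡ X (h ∘ (x ∷_))))

  ∑-splits-[]ʳ : ∀ (X : List A) (h : List A → K) →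
    ∑[ (L , R) ∈ splits X ] (if null R then h L else 0#) ≈ h X
  ∑-splits-[]ʳ []      h = +-identityʳ _
  ∑-splits-[]ʳ (x ∷ X) h = ≈-trans (∑-splits-∷ x X _)
    (≈-trans (∑-cong (splits X) λ _ → +-identityʳ _) (∑-splits-[]ʳ X (h ∘ (x ∷_))))

  -- Both sides distribute the letters over three boxes S, L, R. The head can go into each of them,
  -- so `expand` serves both sides, once with S and L interchanged.
  ∑-splits-exchange : ∀ (X : List A) (k : List A → List A → List A → K) →
    ∑[ (S , N) ∈ splits X ] ∑[ (L , R) ∈ splits N ] k S L R ≈
    ∑[ (L , Z) ∈ splits X ] ∑[ (S , R) ∈ splits Z ] k S L R
  ∑-splits-exchange []      k = ≈-refl
  ∑-splits-exchange (x ∷ X) k = begin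
    ∑[ (S , N) ∈ splits (x ∷ X) ] ∑[ (L , R) ∈ splits N ] k S L R
      ≈⟨ expand k ⟩
    ∑[ (S , N) ∈ splits X ] ∑[ (L , R) ∈ splits N ] (k (x ∷ S) L R + (k S (x ∷ L) R + k S L (x ∷ R)))
      ≈⟨ ∑-splits-exchange X _ ⟩
    ∑[ (L , Z) ∈ splits X ] ∑[ (S , R) ∈ splits Z ] (k (x ∷ S) L R + (k S (x ∷ L) R + k S L (x ∷ R)))
      ≈⟨ ∑-cong (splits X) (λ (L , Z) → ∑-cong (splits Z) λ (S , R) → +.x∙yz≈y∙xz _ _ _) ⟩
    ∑[ (L , Z) ∈ splits X ] ∑[ (S , R) ∈ splits Z ] (k S (x ∷ L) R + (k (x ∷ S) L R + k S L (x ∷ R)))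
      ≈⟨ expand (λ S L R → k L S R) ⟨
    ∑[ (L , Z) ∈ splits (x ∷ X) ] ∑[ (S , R) ∈ splits Z ] k S L R ∎
    where
    expand : (k : List _ → List _ → List _ → K) →
      ∑[ (S , N) ∈ splits (x ∷ X) ] ∑[ (L , R) ∈ splits N ] k S L R ≈
      ∑[ (S , N) ∈ splits X ] ∑[ (L , R) ∈ splits N ] (k (x ∷ S) L R + (k S (x ∷ L) R + k S L (x ∷ R)))
    expand k = ≈-trans (∑-splits-∷ x X _) (∑-cong (splits X) λ (S , N) →
      ≈-trans (+-congˡ (∑-splits-∷ x N _)) (≈-sym (∑-+ (splits N) _ _)))

  -- A Leibniz rule: after a cut the inserted letter x lies in one of the two factors, so it may as
  -- well be inserted there after cutting.
  ∑-cuts-insertion : ∀ x (w : List A) k →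
    ∑[ (l , r) ∈ cuts w ] ∑ (cuts (l ++ x ∷ r)) k ≈
    ∑[ (l , r) ∈ cuts w ] ((∑[ (a , b) ∈ cuts l ] k (a ++ x ∷ b , r)) + (∑[ (a , b) ∈ cuts r ] k (l , a ++ x ∷ b)))
  ∑-cuts-insertion x []      k = +-congʳ (begin
    k ([] , x ∷ []) + (k (x ∷ [] , []) + 0#) ≈⟨ +.x∙yz≈y∙xz _ _ _ ⟩
    k (x ∷ [] , []) + (k ([] , x ∷ []) + 0#) ≈⟨ +-congʳ (+-identityʳ _) ⟨
    (k (x ∷ [] , []) + 0#) + (k ([] , x ∷ []) + 0#) ∎)
  ∑-cuts-insertion x (y ∷ w) k = begin
    ∑[ (l , r) ∈ cuts (y ∷ w) ] ∑ (cuts (l ++ x ∷ r)) k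
      ≡⟨ ∑-cuts-∷ y w _ ⟩
    ∑ (cuts (x ∷ y ∷ w)) k + (∑[ (l , r) ∈ cuts w ] ∑ (cuts (y ∷ l ++ x ∷ r)) k)
      ≈⟨ +-cong
           (≈-trans (reflexive (∑-cuts-∷ x (y ∷ w) k)) (+-congˡ (reflexive (∑-cuts-∷ y w _))))
           (≈-trans (∑-cong (cuts w) λ (l , r) → reflexive (∑-cuts-∷ y (l ++ x ∷ r) k)) (∑-+ (cuts w) _ _)) ⟩
    (k ([] , x ∷ y ∷ w) + (k (x ∷ [] , y ∷ w) + (∑[ (l , r) ∈ cuts w ] k (x ∷ y ∷ l , r)))) +
    ((∑[ (l , r) ∈ cuts w ] k ([] , y ∷ l ++ x ∷ r)) +
     (∑[ (l , r) ∈ cuts w ] ∑[ (a , b) ∈ cuts (l ++ x ∷ r) ] k (y ∷ a , b)))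
      ≈⟨ shuffle _ _ _ _ _ ⟩
    (((k (x ∷ [] , y ∷ w) + 0#) + (k ([] , x ∷ y ∷ w) + (∑[ (l , r) ∈ cuts w ] k ([] , y ∷ l ++ x ∷ r)))) +
    ((∑[ (l , r) ∈ cuts w ] k (x ∷ y ∷ l , r)) +
     (∑[ (l , r) ∈ cuts w ] ∑[ (a , b) ∈ cuts (l ++ x ∷ r) ] k (y ∷ a , b))))
      ≈⟨ +-cong (+-congˡ (reflexive (∑-cuts-∷ y w _))) (+-congˡ (≈-sym (∑-cuts-insertion x w _))) ⟨
    ((k (x ∷ [] , y ∷ w) + 0#) + (∑[ (l , r) ∈ cuts (y ∷ w) ] k ([] , l ++ x ∷ r))) +
    ((∑[ (l , r) ∈ cuts w ] k (x ∷ y ∷ l , r)) +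
     (∑[ (l , r) ∈ cuts w ] ((∑[ (a , b) ∈ cuts l ] k (y ∷ a ++ x ∷ b , r)) + (∑[ (a , b) ∈ cuts r ] k (y ∷ l , a ++ x ∷ b)))))
      ≈⟨ +-congˡ (∑-+ (cuts w) _ _) ⟨
    ((k (x ∷ [] , y ∷ w) + 0#) + (∑[ (l , r) ∈ cuts (y ∷ w) ] k ([] , l ++ x ∷ r))) +
    (∑[ (l , r) ∈ cuts w ] (k (x ∷ y ∷ l , r) +
      ((∑[ (a , b) ∈ cuts l ] k (y ∷ a ++ x ∷ b , r)) + (∑[ (a , b) ∈ cuts r ] k (y ∷ l , a ++ x ∷ b)))))
      ≈⟨ +-congˡ (∑-cong (cuts w) λ (l , r) →
           ≈-trans (≈-sym (+-assoc _ _ _)) (+-congʳ (reflexive (≡.sym (∑-cuts-∷ y l _))))) ⟩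
    ((k (x ∷ [] , y ∷ w) + 0#) + (∑[ (l , r) ∈ cuts (y ∷ w) ] k ([] , l ++ x ∷ r))) +
    (∑[ (l , r) ∈ cuts w ]
      ((∑[ (a , b) ∈ cuts (y ∷ l) ] k (a ++ x ∷ b , r)) + (∑[ (a , b) ∈ cuts r ] k (y ∷ l , a ++ x ∷ b))))
      ≡⟨ ∑-cuts-∷ y w _ ⟨
    ∑[ (l , r) ∈ cuts (y ∷ w) ] ((∑[ (a , b) ∈ cuts l ] k (a ++ x ∷ b , r)) + (∑[ (a , b) ∈ cuts r ] k (l , a ++ x ∷ b))) ∎
    where
    shuffle : ∀ a b c d e → (a + (b + c)) + (d + e) ≈ ((b + 0#) + (a + d)) + (c + e)
    shuffle a b c d e = begin
      (a + (b + c)) + (d + e)        ≈⟨ +-congʳ (+-assoc a b c) ⟨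
      ((a + b) + c) + (d + e)        ≈⟨ +.interchange _ _ _ _ ⟩
      ((a + b) + d) + (c + e)        ≈⟨ +-congʳ (+.xy∙z≈y∙xz _ _ _) ⟩
      (b + (a + d)) + (c + e)        ≈⟨ +-congʳ (+-congʳ (+-identityʳ b)) ⟨
      ((b + 0#) + (a + d)) + (c + e) ∎

  -- The letters to the left of the cut form an arbitrary subset, and the two sides of the cut are
  -- arranged independently. In the induction, `∑-cuts-insertion` decides on which side the head
  -- goes, which matches the recursion of `splits`.
  ∑-arrangements-cuts : ∀ (X : List A) (k : List A → List A → K) →
    ∑[ w ∈ arrangements X ] ∑[ (l , r) ∈ cuts w ] k l r ≈
    ∑[ (L , R) ∈ splits X ] ∑[ l ∈ arrangements L ] ∑[ r ∈ arrangements R ] k l r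
  ∑-arrangements-cuts []      k = +-congʳ (≈-sym (+-identityʳ _))
  ∑-arrangements-cuts (x ∷ X) k = begin
    ∑[ w ∈ arrangements (x ∷ X) ] ∑[ (l , r) ∈ cuts w ] k l r
      ≈⟨ ∑-arrangements-∷ x X _ ⟩
    ∑[ w ∈ arrangements X ] ∑[ (a , b) ∈ cuts w ] ∑[ (l , r) ∈ cuts (a ++ x ∷ b) ] k l r
      ≈⟨ ∑-cong (arrangements X) (λ w → ∑-cuts-insertion x w _) ⟩
    ∑[ w ∈ arrangements X ] ∑[ (l , r) ∈ cuts w ]
      ((∑[ (a , b) ∈ cuts l ] k (a ++ x ∷ b) r) + (∑[ (a , b) ∈ cuts r ] k l (a ++ x ∷ b)))
      ≈⟨ ∑-arrangements-cuts X _ ⟩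
    ∑[ (L , R) ∈ splits X ] ∑[ l ∈ arrangements L ] ∑[ r ∈ arrangements R ]
      ((∑[ (a , b) ∈ cuts l ] k (a ++ x ∷ b) r) + (∑[ (a , b) ∈ cuts r ] k l (a ++ x ∷ b)))
      ≈⟨ ∑-cong (splits X) (λ (L , R) → begin
           ∑[ l ∈ arrangements L ] ∑[ r ∈ arrangements R ]
             ((∑[ (a , b) ∈ cuts l ] k (a ++ x ∷ b) r) + (∑[ (a , b) ∈ cuts r ] k l (a ++ x ∷ b)))
             ≈⟨ ∑-cong (arrangements L) (λ l → ≈-trans (∑-+ (arrangements R) _ _) (+-cong
                  (∑-swap (arrangements R) (cuts l) _) (≈-sym (∑-arrangements-∷ x R _)))) ⟩
           ∑[ l ∈ arrangements L ] ((∑[ (a , b) ∈ cuts l ] ∑[ r ∈ arrangements R ] k (a ++ x ∷ b) r) +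
             (∑[ r ∈ arrangements (x ∷ R) ] k l r))
             ≈⟨ ∑-+ (arrangements L) _ _ ⟩
           (∑[ l ∈ arrangements L ] ∑[ (a , b) ∈ cuts l ] ∑[ r ∈ arrangements R ] k (a ++ x ∷ b) r) +
           (∑[ l ∈ arrangements L ] ∑[ r ∈ arrangements (x ∷ R) ] k l r)
             ≈⟨ +-congʳ (∑-arrangements-∷ x L _) ⟨
           (∑[ l ∈ arrangements (x ∷ L) ] ∑[ r ∈ arrangements R ] k l r) +
           (∑[ l ∈ arrangements L ] ∑[ r ∈ arrangements (x ∷ R) ] k l r) ∎) ⟩
    ∑[ (L , R) ∈ splits X ]
      ((∑[ l ∈ arrangements (x ∷ L) ] ∑[ r ∈ arrangements R ] k l r) +
       (∑[ l ∈ arrangements L ] ∑[ r ∈ arrangements (x ∷ R) ] k l r))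
      ≈⟨ ∑-splits-∷ x X _ ⟨
    ∑[ (L , R) ∈ splits (x ∷ X) ] ∑[ l ∈ arrangements L ] ∑[ r ∈ arrangements R ] k l r ∎

  -- Passes from enumeration by insertion to enumeration by first letter. The value `f []` has to
  -- vanish because the empty list has one arrangement but no first letter.
  ∑-arrangements-picks : ∀ (X : List A) f → f [] ≈ 0# →
    ∑ (arrangements X) f ≈ ∑[ (x , Y) ∈ picks X ] ∑[ w ∈ arrangements Y ] f (x ∷ w)
  ∑-arrangements-picks []      f f[]≈0 = ≈-trans (+-identityʳ _) f[]≈0
  ∑-arrangements-picks (x ∷ X) f f[]≈0 = begin
    ∑ (arrangements (x ∷ X)) f
      ≈⟨ ∑-arrangements-∷ x X f ⟩
    ∑[ w ∈ arrangements X ] ∑[ (l , r) ∈ cuts w ] f (l ++ x ∷ r)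
      ≈⟨ ∑-cong (arrangements X) split ⟩
    ∑[ w ∈ arrangements X ] (f (x ∷ w) + later w)
      ≈⟨ ∑-+ (arrangements X) _ _ ⟩
    (∑[ w ∈ arrangements X ] f (x ∷ w)) + ∑ (arrangements X) later
      ≈⟨ +-congˡ (∑-arrangements-picks X later ≈-refl) ⟩
    (∑[ w ∈ arrangements X ] f (x ∷ w)) +
    (∑[ (y , Y) ∈ picks X ] ∑[ w ∈ arrangements Y ] ∑[ (l , r) ∈ cuts w ] f (y ∷ l ++ x ∷ r))
      ≈⟨ +-congˡ (∑-cong (picks X) λ (y , Y) → ∑-arrangements-∷ x Y _) ⟨
    (∑[ w ∈ arrangements X ] f (x ∷ w)) +
    (∑[ (y , Y) ∈ picks X ] ∑[ w ∈ arrangements (x ∷ Y) ] f (y ∷ w))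
      ≡⟨ ∑-picks-∷ x X _ ⟨
    ∑[ (y , Y) ∈ picks (x ∷ X) ] ∑[ w ∈ arrangements Y ] f (y ∷ w) ∎
    where
    -- The contribution of the words in which x is not the first letter. It vanishes on `[]` by
    -- definition, so the induction hypothesis applies to it.
    later : List _ → K
    later []      = 0#
    later (y ∷ w) = ∑[ (l , r) ∈ cuts w ] f (y ∷ l ++ x ∷ r)

    split : ∀ w → ∑[ (l , r) ∈ cuts w ] f (l ++ x ∷ r) ≈ f (x ∷ w) + later w
    split []      = ≈-refl
    split (y ∷ w) = reflexive (∑-cuts-∷ y w _)

  ∑-cuts-coassoc : ∀ (w : List A) (k : List A → List A → List A → K) →
    ∑[ (u , c) ∈ cuts w ] ∑[ (a , b) ∈ cuts u ] k a b c ≈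
    ∑[ (a , v) ∈ cuts w ] ∑[ (b , c) ∈ cuts v ] k a b c
  ∑-cuts-coassoc []      k = ≈-refl
  ∑-cuts-coassoc (x ∷ w) k = begin
    ∑[ (u , c) ∈ cuts (x ∷ w) ] ∑[ (a , b) ∈ cuts u ] k a b c
      ≡⟨ ∑-cuts-∷ x w _ ⟩
    (k [] [] (x ∷ w) + 0#) + (∑[ (u , c) ∈ cuts w ] ∑[ (a , b) ∈ cuts (x ∷ u) ] k a b c)
      ≈⟨ +-cong (+-identityʳ _) (≈-trans (∑-cong (cuts w) λ (u , c) → reflexive (∑-cuts-∷ x u _)) (∑-+ (cuts w) _ _)) ⟩
    k [] [] (x ∷ w) + ((∑[ (u , c) ∈ cuts w ] k [] (x ∷ u) c) +
                       (∑[ (u , c) ∈ cuts w ] ∑[ (a , b) ∈ cuts u ] k (x ∷ a) b c))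
      ≈⟨ +-assoc _ _ _ ⟨
    (k [] [] (x ∷ w) + (∑[ (u , c) ∈ cuts w ] k [] (x ∷ u) c)) +
    (∑[ (u , c) ∈ cuts w ] ∑[ (a , b) ∈ cuts u ] k (x ∷ a) b c)
      ≈⟨ +-cong (reflexive (≡.sym (∑-cuts-∷ x w _))) (∑-cuts-coassoc w _) ⟩
    (∑[ (b , c) ∈ cuts (x ∷ w) ] k [] b c) +
    (∑[ (a , v) ∈ cuts w ] ∑[ (b , c) ∈ cuts v ] k (x ∷ a) b c)
      ≡⟨ ∑-cuts-∷ x w _ ⟨
    ∑[ (a , v) ∈ cuts (x ∷ w) ] ∑[ (b , c) ∈ cuts v ] k a b c ∎

  -- `normalise` sorts the words by which of x and y comes first; for the two orders of insertion it
  -- yields the same two sums, transposed.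
  ∑-insertions-comm : ∀ x y (w : List A) f →
    ∑[ (l , r) ∈ cuts w ] ∑[ (a , b) ∈ cuts (l ++ x ∷ r) ] f (a ++ y ∷ b) ≈
    ∑[ (l , r) ∈ cuts w ] ∑[ (a , b) ∈ cuts (l ++ y ∷ r) ] f (a ++ x ∷ b)
  ∑-insertions-comm x y w f = begin
    ∑[ (l , r) ∈ cuts w ] ∑[ (a , b) ∈ cuts (l ++ x ∷ r) ] f (a ++ y ∷ b)
      ≈⟨ normalise x y ⟩
    (∑[ (a , v) ∈ cuts w ] ∑[ (b , c) ∈ cuts v ] f (a ++ x ∷ b ++ y ∷ c)) +
    (∑[ (a , v) ∈ cuts w ] ∑[ (b , c) ∈ cuts v ] f (a ++ y ∷ b ++ x ∷ c))
      ≈⟨ +-comm _ _ ⟩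
    (∑[ (a , v) ∈ cuts w ] ∑[ (b , c) ∈ cuts v ] f (a ++ y ∷ b ++ x ∷ c)) +
    (∑[ (a , v) ∈ cuts w ] ∑[ (b , c) ∈ cuts v ] f (a ++ x ∷ b ++ y ∷ c))
      ≈⟨ normalise y x ⟨
    ∑[ (l , r) ∈ cuts w ] ∑[ (a , b) ∈ cuts (l ++ y ∷ r) ] f (a ++ x ∷ b) ∎
    where
    normalise : ∀ x y →
      ∑[ (l , r) ∈ cuts w ] ∑[ (a , b) ∈ cuts (l ++ x ∷ r) ] f (a ++ y ∷ b) ≈
      (∑[ (a , v) ∈ cuts w ] ∑[ (b , c) ∈ cuts v ] f (a ++ x ∷ b ++ y ∷ c)) +
      (∑[ (a , v) ∈ cuts w ] ∑[ (b , c) ∈ cuts v ] f (a ++ y ∷ b ++ x ∷ c))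
    normalise x y = ≈-trans (∑-cuts-insertion x w _) (≈-trans (∑-+ (cuts w) _ _) (+-congʳ
      (≈-trans
        (∑-cong (cuts w) λ (u , c) → ∑-cong (cuts u) λ (a , b) → reflexive (≡.cong f (++-assoc a (x ∷ b) (y ∷ c))))
        (∑-cuts-coassoc w λ a b c → f (a ++ x ∷ b ++ y ∷ c)))))

  -- Needed because the recursion peels off the smallest letter, while a signing of an increasing
  -- list is in general not increasing for `descᴸ`.
  ∑-arrangements-↭ : ∀ {X Y : List A} → X ↭ Y → ∀ f → ∑ (arrangements X) f ≈ ∑ (arrangements Y) f
  ∑-arrangements-↭ refl               f = ≈-refl
  ∑-arrangements-↭ (prep {X} {Y} x p) f = ≈-trans (∑-arrangements-∷ x X f)
    (≈-trans (∑-arrangements-↭ p _) (≈-sym (∑-arrangements-∷ x Y f)))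
  ∑-arrangements-↭ (swap {X} {Y} x y p) f = begin
    ∑ (arrangements (x ∷ y ∷ X)) f
      ≈⟨ ≈-trans (∑-arrangements-∷ x (y ∷ X) f) (∑-arrangements-∷ y X _) ⟩
    ∑[ w ∈ arrangements X ] ∑[ (l , r) ∈ cuts w ] ∑[ (a , b) ∈ cuts (l ++ y ∷ r) ] f (a ++ x ∷ b)
      ≈⟨ ∑-cong (arrangements X) (λ w → ∑-insertions-comm y x w f) ⟩
    ∑[ w ∈ arrangements X ] ∑[ (l , r) ∈ cuts w ] ∑[ (a , b) ∈ cuts (l ++ x ∷ r) ] f (a ++ y ∷ b)
      ≈⟨ ∑-arrangements-↭ p _ ⟩
    ∑[ w ∈ arrangements Y ] ∑[ (l , r) ∈ cuts w ] ∑[ (a , b) ∈ cuts (l ++ x ∷ r) ] f (a ++ y ∷ b)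
      ≈⟨ ≈-trans (∑-arrangements-∷ y (x ∷ Y) f) (∑-arrangements-∷ x Y _) ⟨
    ∑ (arrangements (y ∷ x ∷ Y)) f ∎
  ∑-arrangements-↭ (trans p q)        f = ≈-trans (∑-arrangements-↭ p f) (∑-arrangements-↭ q f)

  -- Permuting the list also permutes the letters within each part of a split, whence the invariance
  -- hypothesis on k.
  ∑-splits-↭ : ∀ {X Y : List A} → X ↭ Y → ∀ k →
    (∀ {L L′ R R′} → L ↭ L′ → R ↭ R′ → k (L , R) ≈ k (L′ , R′)) →
    ∑ (splits X) k ≈ ∑ (splits Y) k
  ∑-splits-↭ refl k resp = ≈-refl
  ∑-splits-↭ (prep {X} {Y} x p) k resp = ≈-trans (∑-splits-∷ x X k)
    (≈-trans (∑-splits-↭ p _ λ l r → +-cong (resp (prep x l) r) (resp l (prep x r)))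
             (≈-sym (∑-splits-∷ x Y k)))
  ∑-splits-↭ (swap {X} {Y} x y p) k resp = begin
    ∑ (splits (x ∷ y ∷ X)) k
      ≈⟨ ≈-trans (∑-splits-∷ x (y ∷ X) k) (∑-splits-∷ y X _) ⟩
    ∑[ (L , R) ∈ splits X ]
      ((k (x ∷ y ∷ L , R) + k (y ∷ L , x ∷ R)) + (k (x ∷ L , y ∷ R) + k (L , x ∷ y ∷ R)))
      ≈⟨ ∑-splits-↭ p _ (λ l r → +-cong (+-cong (resp (prep x (prep y l)) r) (resp (prep y l) (prep x r)))
                                         (+-cong (resp (prep x l) (prep y r)) (resp l (prep x (prep y r))))) ⟩
    ∑[ (L , R) ∈ splits Y ]
      ((k (x ∷ y ∷ L , R) + k (y ∷ L , x ∷ R)) + (k (x ∷ L , y ∷ R) + k (L , x ∷ y ∷ R)))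
      ≈⟨ ∑-cong (splits Y) (λ (L , R) → ≈-trans (+.interchange _ _ _ _) (+-cong
           (+-congʳ (resp (swap x y refl) refl)) (+-congˡ (resp refl (swap x y refl))))) ⟩
    ∑[ (L , R) ∈ splits Y ]
      ((k (y ∷ x ∷ L , R) + k (x ∷ L , y ∷ R)) + (k (y ∷ L , x ∷ R) + k (L , y ∷ x ∷ R)))
      ≈⟨ ≈-trans (∑-splits-∷ y (x ∷ Y) k) (∑-splits-∷ x Y _) ⟨
    ∑ (splits (y ∷ x ∷ Y)) k ∎
  ∑-splits-↭ (trans p q)        k resp = ≈-trans (∑-splits-↭ p k resp) (∑-splits-↭ q k resp)

  ∑-cuts-signings : ∀ (x : A) w f →
    ∑[ (l , r) ∈ cuts w ] ∑ (signings (l ++ x ∷ r)) f ≈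
    ∑[ v ∈ signings w ] ((∑[ (l , r) ∈ cuts v ] f (l ++ (false , x) ∷ r)) +
                         (∑[ (l , r) ∈ cuts v ] f (l ++ (true , x) ∷ r)))
  ∑-cuts-signings x []      f = +-congʳ (+-congʳ (≈-sym (+-identityʳ _)))
  ∑-cuts-signings x (y ∷ w) f = begin
    ∑[ (l , r) ∈ cuts (y ∷ w) ] ∑ (signings (l ++ x ∷ r)) f
      ≡⟨ ∑-cuts-∷ y w _ ⟩
    ∑ (signings (x ∷ y ∷ w)) f + (∑[ (l , r) ∈ cuts w ] ∑ (signings (y ∷ l ++ x ∷ r)) f)
      ≈⟨ +-cong
           (≈-trans (∑-signings-∷ x (y ∷ w) f) (∑-signings-∷ y w _))
           (≈-trans (∑-cong (cuts w) λ (l , r) → ∑-signings-∷ y (l ++ x ∷ r) f)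
             (≈-trans (∑-cuts-signings x w _)
               (∑-cong (signings w) λ v → +-cong (∑-+ (cuts v) _ _) (∑-+ (cuts v) _ _)))) ⟩
    (∑[ v ∈ signings w ] ((f (x⁻ ∷ y⁻ ∷ v) + f (x⁺ ∷ y⁻ ∷ v)) + (f (x⁻ ∷ y⁺ ∷ v) + f (x⁺ ∷ y⁺ ∷ v)))) +
    (∑[ v ∈ signings w ]
      (((∑[ (l , r) ∈ cuts v ] f (y⁻ ∷ l ++ x⁻ ∷ r)) + (∑[ (l , r) ∈ cuts v ] f (y⁺ ∷ l ++ x⁻ ∷ r))) +
       ((∑[ (l , r) ∈ cuts v ] f (y⁻ ∷ l ++ x⁺ ∷ r)) + (∑[ (l , r) ∈ cuts v ] f (y⁺ ∷ l ++ x⁺ ∷ r)))))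
      ≈⟨ ∑-+ (signings w) _ _ ⟨
    ∑[ v ∈ signings w ] (((f (x⁻ ∷ y⁻ ∷ v) + f (x⁺ ∷ y⁻ ∷ v)) + (f (x⁻ ∷ y⁺ ∷ v) + f (x⁺ ∷ y⁺ ∷ v))) +
      (((∑[ (l , r) ∈ cuts v ] f (y⁻ ∷ l ++ x⁻ ∷ r)) + (∑[ (l , r) ∈ cuts v ] f (y⁺ ∷ l ++ x⁻ ∷ r))) +
       ((∑[ (l , r) ∈ cuts v ] f (y⁻ ∷ l ++ x⁺ ∷ r)) + (∑[ (l , r) ∈ cuts v ] f (y⁺ ∷ l ++ x⁺ ∷ r)))))
      ≈⟨ ∑-cong (signings w) (λ v → shuffle _ _ _ _ _ _ _ _) ⟩
    ∑[ v ∈ signings w ]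
      (((f (x⁻ ∷ y⁻ ∷ v) + (∑[ (l , r) ∈ cuts v ] f (y⁻ ∷ l ++ x⁻ ∷ r))) +
        (f (x⁺ ∷ y⁻ ∷ v) + (∑[ (l , r) ∈ cuts v ] f (y⁻ ∷ l ++ x⁺ ∷ r)))) +
       ((f (x⁻ ∷ y⁺ ∷ v) + (∑[ (l , r) ∈ cuts v ] f (y⁺ ∷ l ++ x⁻ ∷ r))) +
        (f (x⁺ ∷ y⁺ ∷ v) + (∑[ (l , r) ∈ cuts v ] f (y⁺ ∷ l ++ x⁺ ∷ r)))))
      ≈⟨ ∑-cong (signings w) (λ v → reflexive (≡.cong₂ _+_
           (≡.cong₂ _+_ (∑-cuts-∷ y⁻ v _) (∑-cuts-∷ y⁻ v _)) (≡.cong₂ _+_ (∑-cuts-∷ y⁺ v _) (∑-cuts-∷ y⁺ v _)))) ⟨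
    ∑[ v ∈ signings w ]
      (((∑[ (l , r) ∈ cuts (y⁻ ∷ v) ] f (l ++ x⁻ ∷ r)) + (∑[ (l , r) ∈ cuts (y⁻ ∷ v) ] f (l ++ x⁺ ∷ r))) +
       ((∑[ (l , r) ∈ cuts (y⁺ ∷ v) ] f (l ++ x⁻ ∷ r)) + (∑[ (l , r) ∈ cuts (y⁺ ∷ v) ] f (l ++ x⁺ ∷ r))))
      ≈⟨ ∑-signings-∷ y w _ ⟨
    ∑[ v ∈ signings (y ∷ w) ] ((∑[ (l , r) ∈ cuts v ] f (l ++ x⁻ ∷ r)) + (∑[ (l , r) ∈ cuts v ] f (l ++ x⁺ ∷ r))) ∎
    where
    x⁻ = (false , x)
    x⁺ = (true , x)
    y⁻ = (false , y)
    y⁺ = (true , y)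

    shuffle : ∀ a b c d p q r s →
      ((a + b) + (c + d)) + ((p + q) + (r + s)) ≈ ((a + p) + (b + r)) + ((c + q) + (d + s))
    shuffle a b c d p q r s = begin
      ((a + b) + (c + d)) + ((p + q) + (r + s)) ≈⟨ +-congˡ (+.interchange _ _ _ _) ⟩
      ((a + b) + (c + d)) + ((p + r) + (q + s)) ≈⟨ +.interchange _ _ _ _ ⟩
      ((a + b) + (p + r)) + ((c + d) + (q + s)) ≈⟨ +-cong (+.interchange _ _ _ _) (+.interchange _ _ _ _) ⟩
      ((a + p) + (b + r)) + ((c + q) + (d + s)) ∎

  -- Attaches the signs to the letters instead of the positions, so that a sign assignment can be
  -- fixed before any word is formed.
  ∑-arrangements-signings : ∀ (X : List A) f →
    ∑[ w ∈ arrangements X ] ∑ (signings w) f ≈ ∑[ Y ∈ signings X ] ∑ (arrangements Y) f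
  ∑-arrangements-signings []      f = ≈-refl
  ∑-arrangements-signings (x ∷ X) f = begin
    ∑[ w ∈ arrangements (x ∷ X) ] ∑ (signings w) f
      ≈⟨ ∑-arrangements-∷ x X _ ⟩
    ∑[ w ∈ arrangements X ] ∑[ (l , r) ∈ cuts w ] ∑ (signings (l ++ x ∷ r)) f
      ≈⟨ ∑-cong (arrangements X) (λ w → ∑-cuts-signings x w f) ⟩
    ∑[ w ∈ arrangements X ] ∑[ v ∈ signings w ]
      ((∑[ (l , r) ∈ cuts v ] f (l ++ (false , x) ∷ r)) + (∑[ (l , r) ∈ cuts v ] f (l ++ (true , x) ∷ r)))
      ≈⟨ ∑-arrangements-signings X _ ⟩
    ∑[ Y ∈ signings X ] ∑[ w ∈ arrangements Y ]
      ((∑[ (l , r) ∈ cuts w ] f (l ++ (false , x) ∷ r)) + (∑[ (l , r) ∈ cuts w ] f (l ++ (true , x) ∷ r)))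
      ≈⟨ ∑-cong (signings X) (λ Y → ≈-trans (∑-+ (arrangements Y) _ _)
           (+-cong (≈-sym (∑-arrangements-∷ _ Y f)) (≈-sym (∑-arrangements-∷ _ Y f)))) ⟩
    ∑[ Y ∈ signings X ] (∑ (arrangements ((false , x) ∷ Y)) f + ∑ (arrangements ((true , x) ∷ Y)) f)
      ≈⟨ ∑-signings-∷ x X _ ⟨
    ∑[ Y ∈ signings (x ∷ X) ] ∑ (arrangements Y) f ∎

  ∑-upTo-suc : ∀ n (f : ℕ → K) → ∑ (upTo (suc n)) f ≡ f 0 + ∑ (upTo n) (f ∘ suc)
  ∑-upTo-suc n f = ≡.cong (f 0 +_) (≡.trans (≡.cong (λ xs → ∑ xs f) (≡.sym (map-upTo suc n))) (∑-map suc (upTo n) f))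

  ∑-upTo-∷ʳ : ∀ n (f : ℕ → K) → ∑ (upTo (suc n)) f ≈ ∑ (upTo n) f + f n
  ∑-upTo-∷ʳ n f = ≈-trans (reflexive (≡.cong (λ xs → ∑ xs f) (≡.sym (applyUpTo-∷ʳ id n))))
    (≈-trans (∑-++ (upTo n) (n ∷ []) f) (+-congˡ (+-identityʳ _)))

  ∑-upTo-cong : ∀ n {f g : ℕ → K} → (∀ {i} → i ℕ.< n → f i ≈ g i) → ∑ (upTo n) f ≈ ∑ (upTo n) g
  ∑-upTo-cong n e = ∑-congᴬ (All.applyUpTo⁺₁ id n e)

  -- The recursion of `splits` on the head of the list becomes Pascal's rule for the number of
  -- splits whose second part has length m.
  ∑-splits-length : ∀ (X : List A) (h : ℕ → ℕ → K) →
    ∑[ (S , R) ∈ splits X ] h (length S) (length R) ≈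
    ∑[ m ∈ upTo (suc (length X)) ] ((length X C m) · h (length X ∸ m) m)
  ∑-splits-length []      h = +-congʳ (≈-sym (+-identityʳ _))
  ∑-splits-length (x ∷ X) h = begin
    ∑[ (S , R) ∈ splits (x ∷ X) ] h (length S) (length R)
      ≈⟨ ∑-splits-∷ x X _ ⟩
    ∑[ (S , R) ∈ splits X ] (h (suc (length S)) (length R) + h (length S) (suc (length R)))
      ≈⟨ ∑-splits-length X (λ i j → h (suc i) j + h i (suc j)) ⟩
    ∑[ m ∈ upTo (suc n) ] ((n C m) · (h (suc (n ∸ m)) m + h (n ∸ m) (suc m)))
      ≈⟨ ≈-trans (∑-cong (upTo (suc n)) λ m → ·.×-distrib-+ _ _ (n C m)) (∑-+ (upTo (suc n)) _ _) ⟩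
    (∑[ m ∈ upTo (suc n) ] ((n C m) · h (suc (n ∸ m)) m)) + (∑[ m ∈ upTo (suc n) ] ((n C m) · h (n ∸ m) (suc m)))
      ≈⟨ +-congʳ (∑-upTo-cong (suc n) λ { {m} (s≤s m≤n) →
           ·.×-congʳ (n C m) (reflexive (≡.cong (λ i → h i m) (≡.sym (ℕ.+-∸-assoc 1 m≤n)))) }) ⟩
    (∑[ m ∈ upTo (suc n) ] ((n C m) · h (suc n ∸ m) m)) + (∑[ m ∈ upTo (suc n) ] ((n C m) · h (n ∸ m) (suc m)))
      -- The vanishing summand with `n C suc n` is added so that, once the summand of index 0 is
      -- split off, both sums run over the same range and Pascal's rule applies termwise.
      ≈⟨ +-congʳ (≈-trans (+-congˡ (·.×-congˡ (k>n⇒nCk≡0 (ℕ.n<1+n n)))) (+-identityʳ _)) ⟨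
    ((∑[ m ∈ upTo (suc n) ] ((n C m) · h (suc n ∸ m) m)) + (n C suc n) · h (n ∸ n) (suc n)) +
    (∑[ m ∈ upTo (suc n) ] ((n C m) · h (n ∸ m) (suc m)))
      ≈⟨ +-congʳ (≈-trans (reflexive (≡.sym (∑-upTo-suc (suc n) _))) (∑-upTo-∷ʳ (suc n) _)) ⟨
    (1 · h (suc n) 0 + (∑[ m ∈ upTo (suc n) ] ((n C suc m) · h (n ∸ m) (suc m)))) +
    (∑[ m ∈ upTo (suc n) ] ((n C m) · h (n ∸ m) (suc m)))
      ≈⟨ ≈-trans (+-assoc _ _ _) (+-congˡ (+-comm _ _)) ⟩
    1 · h (suc n) 0 + ((∑[ m ∈ upTo (suc n) ] ((n C m) · h (n ∸ m) (suc m))) +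
                       (∑[ m ∈ upTo (suc n) ] ((n C suc m) · h (n ∸ m) (suc m))))
      ≈⟨ +-congˡ (∑-+ (upTo (suc n)) _ _) ⟨
    1 · h (suc n) 0 + (∑[ m ∈ upTo (suc n) ] ((n C m) · h (n ∸ m) (suc m) + (n C suc m) · h (n ∸ m) (suc m)))
      ≈⟨ +-congˡ (∑-cong (upTo (suc n)) λ m → ≈-trans (≈-sym (·.×-homo-+ _ (n C m) (n C suc m)))
           (·.×-congˡ (nCk+nC[k+1]≡[n+1]C[k+1] n m))) ⟩
    1 · h (suc n) 0 + (∑[ m ∈ upTo (suc n) ] ((suc n C suc m) · h (n ∸ m) (suc m)))
      ≡⟨ ∑-upTo-suc (suc n) _ ⟨
    ∑[ m ∈ upTo (suc (suc n)) ] ((suc n C m) · h (suc n ∸ m) m) ∎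
    where n = length X

  ∑-filter : ∀ {P : A → Set} (P? : ∀ x → Dec (P x)) xs (f : A → K) →
    ∑ (filter P? xs) f ≈ ∑[ x ∈ xs ] (if does (P? x) then f x else 0#)
  ∑-filter P? []       f = ≈-refl
  ∑-filter P? (x ∷ xs) f with does (P? x)
  ... | true  = +-congˡ (∑-filter P? xs f)
  ... | false = ≈-trans (∑-filter P? xs f) (≈-sym (+-identityˡ _))

  ∑-cartesianProductWith : ∀ (g : A → A′ → A″) xs ys f →
    ∑ (cartesianProductWith g xs ys) f ≈ ∑[ x ∈ xs ] ∑[ y ∈ ys ] f (g x y)
  ∑-cartesianProductWith g []       ys f = ≈-refl
  ∑-cartesianProductWith g (x ∷ xs) ys f = ≈-trans (∑-++ (map (g x) ys) _ f)
    (+-cong (reflexive (∑-map (g x) ys f)) (∑-cartesianProductWith g xs ys f))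

  ∑-cuts-map : ∀ (φ : A → A′) w (k : List A′ × List A′ → K) →
    ∑ (cuts (map φ w)) k ≈ ∑[ (l , r) ∈ cuts w ] k (map φ l , map φ r)
  ∑-cuts-map φ []      k = ≈-refl
  ∑-cuts-map φ (x ∷ w) k = begin
    ∑ (cuts (φ x ∷ map φ w)) k
      ≡⟨ ∑-cuts-∷ (φ x) (map φ w) k ⟩
    k ([] , φ x ∷ map φ w) + (∑[ (l , r) ∈ cuts (map φ w) ] k (φ x ∷ l , r))
      ≈⟨ +-congˡ (∑-cuts-map φ w _) ⟩
    k ([] , φ x ∷ map φ w) + (∑[ (l , r) ∈ cuts w ] k (φ x ∷ map φ l , map φ r))
      ≡⟨ ∑-cuts-∷ x w _ ⟨
    ∑[ (l , r) ∈ cuts (x ∷ w) ] k (map φ l , map φ r) ∎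

  ∑-arrangements-map : ∀ (φ : A → A′) X f → ∑ (arrangements (map φ X)) f ≈ ∑ (arrangements X) (f ∘ map φ)
  ∑-arrangements-map φ []      f = ≈-refl
  ∑-arrangements-map φ (x ∷ X) f = begin
    ∑ (arrangements (φ x ∷ map φ X)) f
      ≈⟨ ∑-arrangements-∷ (φ x) (map φ X) f ⟩
    ∑[ w ∈ arrangements (map φ X) ] ∑[ (l , r) ∈ cuts w ] f (l ++ φ x ∷ r)
      ≈⟨ ∑-arrangements-map φ X _ ⟩
    ∑[ w ∈ arrangements X ] ∑[ (l , r) ∈ cuts (map φ w) ] f (l ++ φ x ∷ r)
      ≈⟨ ∑-cong (arrangements X) (λ w → ≈-trans (∑-cuts-map φ w _)
           (∑-cong (cuts w) λ (l , r) → reflexive (≡.cong f (≡.sym (map-++ φ l (x ∷ r)))))) ⟩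
    ∑[ w ∈ arrangements X ] ∑[ (l , r) ∈ cuts w ] f (map φ (l ++ x ∷ r))
      ≈⟨ ∑-arrangements-∷ x X _ ⟨
    ∑ (arrangements (x ∷ X)) (f ∘ map φ) ∎

  ∑-signings-map : ∀ (φ : A → A′) X f → ∑ (signings (map φ X)) f ≈ ∑ (signings X) (f ∘ map (map₂ φ))
  ∑-signings-map φ []      f = ≈-refl
  ∑-signings-map φ (x ∷ X) f = ≈-trans (∑-signings-∷ (φ x) (map φ X) f)
    (≈-trans (∑-signings-map φ X _) (≈-sym (∑-signings-∷ x X _)))

-- Descent patterns of words before an end letter

-- The descents of a word followed by an end letter; `end x` says whether x is
-- larger than the end letter.
descents : (A → A → Bool) → (A → Bool) → List A → List Bool
descents desc end []          = []
descents desc end (x ∷ [])    = end x ∷ []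
descents desc end (x ∷ y ∷ w) = desc x y ∷ descents desc end (y ∷ w)

null-↭ : ∀ {X Y : List A} → X ↭ Y → null X ≡ null Y
null-↭ refl         = ≡.refl
null-↭ (prep x p)   = ≡.refl
null-↭ (swap x y p) = ≡.refl
null-↭ (trans p q)  = ≡.trans (null-↭ p) (null-↭ q)

null-∧ : ∀ (X : List A) {b} → b ≡ false → null X ∧ b ≡ false
null-∧ []      e = e
null-∧ (_ ∷ _) _ = ≡.refl

module _ {desc : A → A → Bool} where

  -- Seen from l, the letter m plays the role of the end letter.
  descents-++ : ∀ {end} l m r →
    descents desc end (l ++ m ∷ r) ≡ descents desc (λ x → desc x m) l ++ descents desc end (m ∷ r)
  descents-++ []          m r = ≡.refl
  descents-++ (x ∷ [])    m r = ≡.refl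
  descents-++ (x ∷ y ∷ l) m r = ≡.cong (desc x y ∷_) (descents-++ (y ∷ l) m r)

  descents-cong : ∀ {end end′ w} → All (λ x → end x ≡ end′ x) w → descents desc end w ≡ descents desc end′ w
  descents-cong []           = ≡.refl
  descents-cong (e ∷ [])     = ≡.cong (_∷ []) e
  descents-cong (_ ∷ e ∷ es) = ≡.cong (_ ∷_) (descents-cong (e ∷ es))

  descents-min : ∀ {end m r} → All (λ x → desc m x ≡ false) r →
    descents desc end (m ∷ r) ≡ (null r ∧ end m) ∷ descents desc end r
  descents-min []      = ≡.refl
  descents-min {end} {r = r} (e ∷ _) = ≡.cong (_∷ descents desc end r) e

descents-map : ∀ {desc : A → A → Bool} {end : A → Bool} {desc′ : A′ → A′ → Bool} {end′ : A′ → Bool} (φ : A → A′) →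
  (∀ x y → desc′ (φ x) (φ y) ≡ desc x y) → (∀ x → end′ (φ x) ≡ end x) →
  ∀ w → descents desc′ end′ (map φ w) ≡ descents desc end w
descents-map φ d e []          = ≡.refl
descents-map φ d e (x ∷ [])    = ≡.cong (_∷ []) (e x)
descents-map φ d e (x ∷ y ∷ w) = ≡.cong₂ _∷_ (d x y) (descents-map φ d e (y ∷ w))

-- (false , x) is smaller than the end letter and (true , x) is larger.
Letter : ℕ → Set
Letter n = Bool × Fin n

descᴸ : ∀ {n} → Letter n → Letter n → Bool
descᴸ (false , x) (true  , y) = false
descᴸ (true  , x) (false , y) = true
descᴸ (false , x) (false , y) = toℕ y <ᵇ toℕ x
descᴸ (true  , x) (true  , y) = toℕ y <ᵇ toℕ x

<ᵇ-true : ∀ {m n} → m ℕ.< n → (m <ᵇ n) ≡ true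
<ᵇ-true {zero}  {suc n} _       = ≡.refl
<ᵇ-true {suc m} {suc n} (s≤s l) = <ᵇ-true l

<ᵇ-false : ∀ {m n} → n ℕ.≤ m → (m <ᵇ n) ≡ false
<ᵇ-false {m}     {zero}  _       = ≡.refl
<ᵇ-false {suc m} {suc n} (s≤s l) = <ᵇ-false l

-- The rearrangement puts the small letters before the large ones. Both groups are sublists of X, so
-- they are increasing whenever X is.
signings-sort : ∀ (X : List A) → All (λ Y → ∃₂ λ N P →
   N ⊆ X × P ⊆ X × Y ↭ map (false ,_) N ++ map (true ,_) P) (signings X)
signings-sort []      = ([] , [] , [] , [] , refl) ∷ []
signings-sort (x ∷ X) = All.concat⁺ (All.map⁺ (All.map
  (λ (N , P , N⊆X , P⊆X , Y↭) →
      (x ∷ N , P , ≡.refl ∷ N⊆X , x ∷ʳ P⊆X , prep _ Y↭)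
    ∷ (N , x ∷ P , x ∷ʳ N⊆X , ≡.refl ∷ P⊆X ,
       ↭-trans (prep _ Y↭) (↭-sym (Perm.shift (true , x) (map (false ,_) N) (map (true ,_) P))))
    ∷ [])
  (signings-sort X)))

-- Weights of descent patterns

module Weights (R : CommutativeSemiring 0ℓ 0ℓ) (t : CommutativeSemiring.Carrier R) where

  open CommutativeSemiring R renaming (Carrier to K; refl to ≈-refl; sym to ≈-sym; trans to ≈-trans)
  open RawSemiringDefinitions rawSemiring using (_^_)
  open SetoidReasoning setoid
  open Sums R
  private module * = CommutativeSemigroupProperties *-commutativeSemigroup

  t^des : List Bool → K
  t^des []       = 1#
  t^des (b ∷ bs) = (if b then t else 1#) * t^des bs

  -- t^i (1 + t)^j for a pattern with i descents, no two consecutive, where j counts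
  -- the positions that neither are nor follow a descent; 0 for the other patterns.
  -- The first argument says whether the preceding position is a descent.
  γ-weight : Bool → List Bool → K
  γ-weight _     []           = 1#
  γ-weight false (false ∷ bs) = (1# + t) * γ-weight false bs
  γ-weight false (true  ∷ bs) = t * γ-weight true bs
  γ-weight true  (false ∷ bs) = γ-weight false bs
  γ-weight true  (true  ∷ bs) = 0#

  t^des-++ : ∀ as bs → t^des (as ++ bs) ≈ t^des as * t^des bs
  t^des-++ []       bs = ≈-sym (*-identityˡ _)
  t^des-++ (a ∷ as) bs = ≈-trans (*-congˡ (t^des-++ as bs)) (≈-sym (*-assoc _ _ _))

  -- This is t^|S| if all letters of S are small, and 0 otherwise: large letters are never placed
  -- behind the end letter.
  t^small : (A → Bool) → List A → K
  t^small end []      = 1#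
  t^small end (x ∷ S) = (if end x then 0# else t) * t^small end S

  module _ {A : Set} (desc : A → A → Bool) where

    private
      ds : (A → Bool) → List A → List Bool
      ds = descents desc

      -∞ : A → Bool
      -∞ = const true

    -- Before -∞ the last letter of a nonempty word is always a descent. The ascent after it
    -- therefore has factor 1 and resets the flag of `γ-weight` to `false`, so that the weight
    -- factors.
    γ-weight-valley : ∀ p x l bs →
      γ-weight p (ds -∞ (x ∷ l) ++ false ∷ bs) ≈ γ-weight p (ds -∞ (x ∷ l)) * γ-weight false bs
    γ-weight-valley false x []      bs = *-congʳ (≈-sym (*-identityʳ t))
    γ-weight-valley true  x []      bs = ≈-sym (zeroˡ _)
    γ-weight-valley p     x (y ∷ l) bs with p | desc x y
    ... | false | false = ≈-trans (*-congˡ (γ-weight-valley false y l bs)) (≈-sym (*-assoc _ _ _))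
    ... | false | true  = ≈-trans (*-congˡ (γ-weight-valley true y l bs)) (≈-sym (*-assoc _ _ _))
    ... | true  | false = γ-weight-valley false y l bs
    ... | true  | true  = ≈-sym (zeroˡ _)

    -- The last letter of `x ∷ l` is a descent before -∞, and here it is followed by another
    -- descent.
    γ-weight-double : ∀ p x l bs → γ-weight p (ds -∞ (x ∷ l) ++ true ∷ bs) ≈ 0#
    γ-weight-double false x []      bs = zeroʳ t
    γ-weight-double true  x []      bs = ≈-refl
    γ-weight-double p     x (y ∷ l) bs with p | desc x y
    ... | false | false = ≈-trans (*-congˡ (γ-weight-double false y l bs)) (zeroʳ _)
    ... | false | true  = ≈-trans (*-congˡ (γ-weight-double true y l bs)) (zeroʳ _)
    ... | true  | false = γ-weight-double false y l bs
    ... | true  | true  = ≈-refl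

    -- Recursions at the smallest letter

    Des Γ : (A → Bool) → List A → K
    Des end X = ∑[ w ∈ arrangements X ] t^des (ds end w)
    Γ   end X = ∑[ w ∈ arrangements X ] γ-weight false (ds end w)

    infix 4 _≺_
    -- No order axioms are imposed on `desc`. For a list with `AllPairs _≺_`, the relation records
    -- the outcome of both comparisons of any two letters, and this is all the recursions use.
    _≺_ : A → A → Set
    x ≺ y = desc y x ≡ true × desc x y ≡ false

    -- A word over m ∷ X is l m r.  As m is minimal, l has the descents it would have
    -- before -∞, and m is a descent only if r is empty.
    ∑-arrangements-min : ∀ end {m X} → All (m ≺_) X → (φ : List Bool → K) →
      ∑[ w ∈ arrangements (m ∷ X) ] φ (ds end w) ≈
      ∑[ (L , R) ∈ splits X ] ∑[ l ∈ arrangements L ] ∑[ r ∈ arrangements R ]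
        φ (ds -∞ l ++ (null R ∧ end m) ∷ ds end r)
    ∑-arrangements-min end {m} {X} m≺X φ = begin
      ∑[ w ∈ arrangements (m ∷ X) ] φ (ds end w)
        ≈⟨ ∑-arrangements-∷ m X _ ⟩
      ∑[ w ∈ arrangements X ] ∑[ (l , r) ∈ cuts w ] φ (ds end (l ++ m ∷ r))
        ≈⟨ ∑-arrangements-cuts X _ ⟩
      ∑[ (L , R) ∈ splits X ] ∑[ l ∈ arrangements L ] ∑[ r ∈ arrangements R ] φ (ds end (l ++ m ∷ r))
        ≈⟨ ∑-splits-cong X (λ {L} {R} L⊆X R⊆X →
             ∑-arrangements-cong L λ l↭L → ∑-arrangements-cong R λ r↭R →
             reflexive (≡.cong φ (pattern-of l↭L L⊆X r↭R R⊆X))) ⟩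
      ∑[ (L , R) ∈ splits X ] ∑[ l ∈ arrangements L ] ∑[ r ∈ arrangements R ]
        φ (ds -∞ l ++ (null R ∧ end m) ∷ ds end r) ∎
      where
      m≺ : ∀ {l L} → l ↭ L → L ⊆ X → All (m ≺_) l
      m≺ p s = Perm.All-resp-↭ (↭-sym p) (Sublist.All-resp-⊆ s m≺X)

      pattern-of : ∀ {L R l r} → l ↭ L → L ⊆ X → r ↭ R → R ⊆ X →
        ds end (l ++ m ∷ r) ≡ ds -∞ l ++ (null R ∧ end m) ∷ ds end r
      pattern-of {L} {R} {l} {r} l↭L L⊆X r↭R R⊆X = ≡.trans (descents-++ l m r) (≡.cong₂ _++_
        (descents-cong (All.map proj₁ (m≺ l↭L L⊆X)))
        (≡.trans (descents-min (All.map (proj₂) (m≺ r↭R R⊆X)))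
                 (≡.cong (λ b → (b ∧ end m) ∷ ds end r) (null-↭ r↭R))))

    Des-min : ∀ end {m X} → All (m ≺_) X →
      Des end (m ∷ X) ≈ ∑[ (L , R) ∈ splits X ] (Des -∞ L * ((if null R ∧ end m then t else 1#) * Des end R))
    Des-min end {m} {X} m≺X = ≈-trans (∑-arrangements-min end m≺X t^des)
      (∑-cong (splits X) λ (L , R) → ≈-trans
        (∑-cong (arrangements L) λ l → ∑-cong (arrangements R) λ r → t^des-++ (ds -∞ l) _)
        (≈-trans (∑-× (arrangements L) (arrangements R) _ _) (*-congˡ (∑-*ˡ _ (arrangements R) _))))

    -- Behind a nonempty L, the letter m is a valley and the weights multiply. If L is empty, m has
    -- weight 1 + t: the 1 completes the product, since `Γ -∞ []` is 1, and the t gives the extra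
    -- summand.
    Γ-ascent : ∀ end L R →
      ∑[ l ∈ arrangements L ] ∑[ r ∈ arrangements R ] γ-weight false (ds -∞ l ++ false ∷ ds end r) ≈
      Γ -∞ L * Γ end R + (if null L then t * Γ end R else 0#)
    Γ-ascent end [] R = begin
      (∑[ r ∈ arrangements R ] ((1# + t) * γ-weight false (ds end r))) + 0#
        ≈⟨ ≈-trans (+-identityʳ _) (∑-*ˡ _ (arrangements R) _) ⟩
      (1# + t) * Γ end R
        ≈⟨ distribʳ _ _ _ ⟩
      1# * Γ end R + t * Γ end R
        ≈⟨ +-congʳ (*-congʳ (+-identityʳ 1#)) ⟨
      (1# + 0#) * Γ end R + t * Γ end R ∎
    Γ-ascent end L@(x ∷ _) R = begin
      ∑[ l ∈ arrangements L ] ∑[ r ∈ arrangements R ] γ-weight false (ds -∞ l ++ false ∷ ds end r)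
        ≈⟨ ∑-arrangements-cong L (λ {l} p → ∑-cong (arrangements R) λ r → valley l p _) ⟩
      ∑[ l ∈ arrangements L ] ∑[ r ∈ arrangements R ] (γ-weight false (ds -∞ l) * γ-weight false (ds end r))
        ≈⟨ ∑-× (arrangements L) (arrangements R) _ _ ⟩
      Γ -∞ L * Γ end R
        ≈⟨ +-identityʳ _ ⟨
      Γ -∞ L * Γ end R + 0# ∎
      where
      valley : ∀ l → l ↭ L → ∀ bs →
        γ-weight false (ds -∞ l ++ false ∷ bs) ≈ γ-weight false (ds -∞ l) * γ-weight false bs
      valley []      p bs with () ← null-↭ p
      valley (x ∷ l) p bs = γ-weight-valley false x l bs

    -- A nonempty L ends in a descent immediately before the descent m; only the word with m as its
    -- single letter survives.
    Γ-descent : ∀ L →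
      ∑[ l ∈ arrangements L ] γ-weight false (ds -∞ l ++ true ∷ []) ≈ (if null L then t else 0#)
    Γ-descent []        = ≈-trans (+-identityʳ _) (*-identityʳ t)
    Γ-descent L@(x ∷ _) = ≈-trans (∑-arrangements-cong L λ {l} p → double l p) (∑-0 (arrangements L))
      where
      double : ∀ l → l ↭ L → γ-weight false (ds -∞ l ++ true ∷ []) ≈ 0#
      double []      p with () ← null-↭ p
      double (x ∷ l) p = γ-weight-double false x l []

    Des-[] : ∀ end → Des end [] ≈ 1#
    Des-[] end = +-identityʳ 1#

    Γ-[] : ∀ end → Γ end [] ≈ 1#
    Γ-[] end = +-identityʳ 1#

    -- The letter m is a descent only if it comes last. This is the split with empty R and L = X,
    -- which gives the summand with t.
    Des-min-∞ : ∀ {m X} → All (m ≺_) X →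
      Des -∞ (m ∷ X) ≈ (∑[ (L , R) ∈ splits X ] (if null R then 0# else Des -∞ L * Des -∞ R)) + t * Des -∞ X
    Des-min-∞ {m} {X} m≺X = begin
      Des -∞ (m ∷ X)
        ≈⟨ Des-min -∞ m≺X ⟩
      ∑[ (L , R) ∈ splits X ] (Des -∞ L * ((if null R ∧ true then t else 1#) * Des -∞ R))
        ≈⟨ ∑-cong (splits X) (λ (L , R) → separate L R) ⟩
      ∑[ (L , R) ∈ splits X ] ((if null R then 0# else Des -∞ L * Des -∞ R) + (if null R then t * Des -∞ L else 0#))
        ≈⟨ ∑-+ (splits X) _ _ ⟩
      (∑[ (L , R) ∈ splits X ] (if null R then 0# else Des -∞ L * Des -∞ R)) +
      (∑[ (L , R) ∈ splits X ] (if null R then t * Des -∞ L else 0#))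
        ≈⟨ +-congˡ (∑-splits-[]ʳ X _) ⟩
      (∑[ (L , R) ∈ splits X ] (if null R then 0# else Des -∞ L * Des -∞ R)) + t * Des -∞ X ∎
      where
      separate : ∀ L R →
        Des -∞ L * ((if null R ∧ true then t else 1#) * Des -∞ R) ≈
        (if null R then 0# else Des -∞ L * Des -∞ R) + (if null R then t * Des -∞ L else 0#)
      separate L []      = ≈-trans (*-congˡ (≈-trans (*-congˡ (Des-[] -∞)) (*-identityʳ t)))
        (≈-trans (*-comm _ _) (≈-sym (+-identityˡ _)))
      separate L (_ ∷ _) = ≈-trans (*-congˡ (*-identityˡ _)) (≈-sym (+-identityʳ _))

    -- Here the summand with t comes from empty L, that is, from m in first place: it is the t of 1
    -- + t if R is nonempty, and the weight of a one-letter word if R is empty too. With R empty and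
    -- L nonempty, m is a second consecutive descent and the weight is 0.
    Γ-min-∞ : ∀ {m X} → All (m ≺_) X →
      Γ -∞ (m ∷ X) ≈ (∑[ (L , R) ∈ splits X ] (if null R then 0# else Γ -∞ L * Γ -∞ R)) + t * Γ -∞ X
    Γ-min-∞ {m} {X} m≺X = begin
      Γ -∞ (m ∷ X)
        ≈⟨ ∑-arrangements-min -∞ m≺X (γ-weight false) ⟩
      ∑[ (L , R) ∈ splits X ] ∑[ l ∈ arrangements L ] ∑[ r ∈ arrangements R ]
        γ-weight false (ds -∞ l ++ (null R ∧ true) ∷ ds -∞ r)
        ≈⟨ ∑-cong (splits X) (λ (L , R) → separate L R) ⟩
      ∑[ (L , R) ∈ splits X ] ((if null R then 0# else Γ -∞ L * Γ -∞ R) + (if null L then t * Γ -∞ R else 0#))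
        ≈⟨ ∑-+ (splits X) _ _ ⟩
      (∑[ (L , R) ∈ splits X ] (if null R then 0# else Γ -∞ L * Γ -∞ R)) +
      (∑[ (L , R) ∈ splits X ] (if null L then t * Γ -∞ R else 0#))
        ≈⟨ +-congˡ (∑-splits-[]ˡ X _) ⟩
      (∑[ (L , R) ∈ splits X ] (if null R then 0# else Γ -∞ L * Γ -∞ R)) + t * Γ -∞ X ∎
      where
      null-if : ∀ L → (if null L then t else 0#) ≈ 0# + (if null L then t * Γ -∞ [] else 0#)
      null-if []      = ≈-sym (≈-trans (+-identityˡ _) (≈-trans (*-congˡ (Γ-[] -∞)) (*-identityʳ t)))
      null-if (_ ∷ _) = ≈-sym (+-identityˡ _)

      separate : ∀ L R →
        ∑[ l ∈ arrangements L ] ∑[ r ∈ arrangements R ] γ-weight false (ds -∞ l ++ (null R ∧ true) ∷ ds -∞ r) ≈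
        (if null R then 0# else Γ -∞ L * Γ -∞ R) + (if null L then t * Γ -∞ R else 0#)
      separate L []        = ≈-trans (∑-cong (arrangements L) λ l → +-identityʳ _)
        (≈-trans (Γ-descent L) (null-if L))
      separate L R@(_ ∷ _) = Γ-ascent -∞ L R

    -- For nonempty X this is the classical γ-expansion of the Eulerian polynomial, multiplied by t
    -- because the last position always is a descent before -∞.
    Des≈Γ-∞ : ∀ {X} → AllPairs _≺_ X → Des -∞ X ≈ Γ -∞ X
    Des≈Γ-∞ {X} = go (length X) X ℕ.≤-refl
      where
      -- The recursion leads to arbitrary sublists of X, hence induction on a bound for the length.
      go : ∀ n X → length X ℕ.≤ n → AllPairs _≺_ X → Des -∞ X ≈ Γ -∞ X
      go _       []      _         _           = ≈-refl
      go (suc n) (m ∷ X) (s≤s ∣X∣≤n) (m≺X ∷ ≺X) = begin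
        Des -∞ (m ∷ X)
          ≈⟨ Des-min-∞ m≺X ⟩
        (∑[ (L , R) ∈ splits X ] (if null R then 0# else Des -∞ L * Des -∞ R)) + t * Des -∞ X
          ≈⟨ +-cong (∑-splits-cong X λ L⊆X R⊆X → if-cong _ (*-cong (ih L⊆X) (ih R⊆X))) (*-congˡ (go n X ∣X∣≤n ≺X)) ⟩
        (∑[ (L , R) ∈ splits X ] (if null R then 0# else Γ -∞ L * Γ -∞ R)) + t * Γ -∞ X
          ≈⟨ Γ-min-∞ m≺X ⟨
        Γ -∞ (m ∷ X) ∎
        where
        ih : ∀ {L} → L ⊆ X → Des -∞ L ≈ Γ -∞ L
        ih L⊆X = go n _ (ℕ.≤-trans (Sublist.length-mono-≤ L⊆X) ∣X∣≤n) (AllPairs-resp-⊆ L⊆X ≺X)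

        if-cong : ∀ b {x y} → x ≈ y → (if b then 0# else x) ≈ (if b then 0# else y)
        if-cong false x≈y = x≈y
        if-cong true  x≈y = ≈-refl

    -- Words with small and large letters

    module _ (end : A → Bool) (end-mono : ∀ {x y} → x ≺ y → end x ≡ true → end y ≡ true) where

      -- The letters of S are thought of as placed after the end letter, in decreasing order.
      D̃es : List A → K
      D̃es X = ∑[ (S , R) ∈ splits X ] (t^small end S * Des end R)

      -- Moving m behind the end letter gives `t * D̃es X`. Otherwise the word is l m r, and m is no
      -- descent because it is small. Choosing L before S, by `∑-splits-exchange`, lets S and R
      -- recombine to `D̃es`.
      D̃es-min : ∀ {m X} → end m ≡ false → All (m ≺_) X →
        D̃es (m ∷ X) ≈ (∑[ (L , R) ∈ splits X ] (Des -∞ L * D̃es R)) + t * D̃es X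
      D̃es-min {m} {X} m<end m≺X = begin
        D̃es (m ∷ X)
          ≈⟨ ∑-splits-∷ m X _ ⟩
        ∑[ (S , N) ∈ splits X ] (t^small end (m ∷ S) * Des end N + t^small end S * Des end (m ∷ N))
          ≈⟨ ∑-splits-cong X (λ {S} {N} _ N⊆X → +-cong (first S N) (second S N⊆X)) ⟩
        ∑[ (S , N) ∈ splits X ] (t * (t^small end S * Des end N) +
          (∑[ (L , R) ∈ splits N ] (Des -∞ L * (t^small end S * Des end R))))
          ≈⟨ ∑-+ (splits X) _ _ ⟩
        (∑[ (S , N) ∈ splits X ] (t * (t^small end S * Des end N))) +
        (∑[ (S , N) ∈ splits X ] ∑[ (L , R) ∈ splits N ] (Des -∞ L * (t^small end S * Des end R)))
          ≈⟨ +-cong (∑-*ˡ t (splits X) _) (∑-splits-exchange X (λ S L R → Des -∞ L * (t^small end S * Des end R))) ⟩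
        t * D̃es X + (∑[ (L , Z) ∈ splits X ] ∑[ (S , R) ∈ splits Z ] (Des -∞ L * (t^small end S * Des end R)))
          ≈⟨ +-comm _ _ ⟩
        (∑[ (L , Z) ∈ splits X ] ∑[ (S , R) ∈ splits Z ] (Des -∞ L * (t^small end S * Des end R))) + t * D̃es X
          ≈⟨ +-congʳ (∑-cong (splits X) λ (L , Z) → ∑-*ˡ _ (splits Z) _) ⟩
        (∑[ (L , R) ∈ splits X ] (Des -∞ L * D̃es R)) + t * D̃es X ∎
        where
        first : ∀ S N → t^small end (m ∷ S) * Des end N ≈ t * (t^small end S * Des end N)
        first S N = ≈-trans (*-congʳ (*-congʳ (reflexive (≡.cong (if_then 0# else t) m<end)))) (*-assoc _ _ _)

        one : ∀ N → (if null N ∧ end m then t else 1#) ≈ 1#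
        one N = reflexive (≡.cong (if_then t else 1#) (null-∧ N m<end))

        second : ∀ S {N} → N ⊆ X →
          t^small end S * Des end (m ∷ N) ≈ ∑[ (L , R) ∈ splits N ] (Des -∞ L * (t^small end S * Des end R))
        second S {N} N⊆X = begin
          t^small end S * Des end (m ∷ N)
            ≈⟨ *-congˡ (Des-min end (Sublist.All-resp-⊆ N⊆X m≺X)) ⟩
          t^small end S * (∑[ (L , R) ∈ splits N ] (Des -∞ L * ((if null R ∧ end m then t else 1#) * Des end R)))
            ≈⟨ ∑-*ˡ _ (splits N) _ ⟨
          ∑[ (L , R) ∈ splits N ] (t^small end S * (Des -∞ L * ((if null R ∧ end m then t else 1#) * Des end R)))
            ≈⟨ ∑-cong (splits N) (λ (L , R) → ≈-trans (*-congˡ (*-congˡ (≈-trans (*-congʳ (one R)) (*-identityˡ _))))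
                 (*.x∙yz≈y∙xz _ _ _)) ⟩
          ∑[ (L , R) ∈ splits N ] (Des -∞ L * (t^small end S * Des end R)) ∎

      Γ-min : ∀ {m X} → end m ≡ false → All (m ≺_) X →
        Γ end (m ∷ X) ≈ (∑[ (L , R) ∈ splits X ] (Γ -∞ L * Γ end R)) + t * Γ end X
      Γ-min {m} {X} m<end m≺X = begin
        Γ end (m ∷ X)
          ≈⟨ ∑-arrangements-min end m≺X (γ-weight false) ⟩
        ∑[ (L , R) ∈ splits X ] ∑[ l ∈ arrangements L ] ∑[ r ∈ arrangements R ]
          γ-weight false (ds -∞ l ++ (null R ∧ end m) ∷ ds end r)
          ≈⟨ ∑-cong (splits X) (λ (L , R) → ≈-trans
               (∑-cong (arrangements L) λ l → ∑-cong (arrangements R) λ r →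
                 reflexive (≡.cong (λ b → γ-weight false (ds -∞ l ++ b ∷ ds end r)) (null-∧ R m<end)))
               (Γ-ascent end L R)) ⟩
        ∑[ (L , R) ∈ splits X ] (Γ -∞ L * Γ end R + (if null L then t * Γ end R else 0#))
          ≈⟨ ∑-+ (splits X) _ _ ⟩
        (∑[ (L , R) ∈ splits X ] (Γ -∞ L * Γ end R)) + (∑[ (L , R) ∈ splits X ] (if null L then t * Γ end R else 0#))
          ≈⟨ +-congˡ (∑-splits-[]ˡ X _) ⟩
        (∑[ (L , R) ∈ splits X ] (Γ -∞ L * Γ end R)) + t * Γ end X ∎

      -- Without small letters S has to be empty, and the end letter lies below all letters, just as
      -- -∞ does.
      D̃es≈Γ-large : ∀ {X} → AllPairs _≺_ X → All (λ x → end x ≡ true) X → D̃es X ≈ Γ end X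
      D̃es≈Γ-large {X} ≺X large = begin
        ∑[ (S , R) ∈ splits X ] (t^small end S * Des end R)
          ≈⟨ ∑-splits-cong X (λ {S} {R} S⊆X _ → empty S R (Sublist.All-resp-⊆ S⊆X large)) ⟩
        ∑[ (S , R) ∈ splits X ] (if null S then Des end R else 0#)
          ≈⟨ ∑-splits-[]ˡ X _ ⟩
        Des end X
          ≈⟨ ∑-arrangements-cong X (λ p → reflexive (≡.cong t^des (descents-cong (Perm.All-resp-↭ (↭-sym p) large)))) ⟩
        Des -∞ X
          ≈⟨ Des≈Γ-∞ ≺X ⟩
        Γ -∞ X
          ≈⟨ ∑-arrangements-cong X (λ p → reflexive (≡.cong (γ-weight false) (descents-cong (Perm.All-resp-↭ (↭-sym p) large)))) ⟨
        Γ end X ∎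
        where
        empty : ∀ S R → All (λ x → end x ≡ true) S → t^small end S * Des end R ≈ (if null S then Des end R else 0#)
        empty []      R _       = *-identityˡ _
        empty (x ∷ S) R (e ∷ _) =
          ≈-trans (*-congʳ (≈-trans (*-congʳ (reflexive (≡.cong (if_then 0# else t) e))) (zeroˡ _))) (zeroˡ _)

      D̃es≈Γ-sorted : ∀ {X} → AllPairs _≺_ X → D̃es X ≈ Γ end X
      D̃es≈Γ-sorted {X} = go (length X) X ℕ.≤-refl
        where
        go : ∀ n X → length X ℕ.≤ n → AllPairs _≺_ X → D̃es X ≈ Γ end X
        go _ [] _ ≺X = D̃es≈Γ-large ≺X []
        go (suc n) (m ∷ X) (s≤s ∣X∣≤n) (m≺X ∷ ≺X) = cases (end m) ≡.refl
          where
          ih : ∀ {R} → R ⊆ X → D̃es R ≈ Γ end R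
          ih R⊆X = go n _ (ℕ.≤-trans (Sublist.length-mono-≤ R⊆X) ∣X∣≤n) (AllPairs-resp-⊆ R⊆X ≺X)

          cases : ∀ b → end m ≡ b → D̃es (m ∷ X) ≈ Γ end (m ∷ X)
          -- If the smallest letter is large, all letters are; the recursion stops here.
          cases true  eq = D̃es≈Γ-large (m≺X ∷ ≺X) (eq ∷ All.map (λ m≺x → end-mono m≺x eq) m≺X)
          cases false eq = begin
            D̃es (m ∷ X)
              ≈⟨ D̃es-min eq m≺X ⟩
            (∑[ (L , R) ∈ splits X ] (Des -∞ L * D̃es R)) + t * D̃es X
              ≈⟨ +-cong (∑-splits-cong X λ L⊆X R⊆X → *-cong (Des≈Γ-∞ (AllPairs-resp-⊆ L⊆X ≺X)) (ih R⊆X))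
                        (*-congˡ (go n X ∣X∣≤n ≺X)) ⟩
            (∑[ (L , R) ∈ splits X ] (Γ -∞ L * Γ end R)) + t * Γ end X
              ≈⟨ Γ-min eq m≺X ⟨
            Γ end (m ∷ X) ∎

      t^small-↭ : ∀ {S S′} → S ↭ S′ → t^small end S ≈ t^small end S′
      t^small-↭ refl         = ≈-refl
      t^small-↭ (prep x p)   = *-congˡ (t^small-↭ p)
      t^small-↭ (swap x y p) = ≈-trans (*.x∙yz≈y∙xz _ _ _) (*-congˡ (*-congˡ (t^small-↭ p)))
      t^small-↭ (trans p q)  = ≈-trans (t^small-↭ p) (t^small-↭ q)

      D̃es≈Γ : ∀ {X Y} → X ↭ Y → AllPairs _≺_ Y → D̃es X ≈ Γ end X
      D̃es≈Γ {X} {Y} X↭Y ≺Y = begin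
        D̃es X   ≈⟨ ∑-splits-↭ X↭Y _ (λ p q → *-cong (t^small-↭ p) (∑-arrangements-↭ q _)) ⟩
        D̃es Y   ≈⟨ D̃es≈Γ-sorted ≺Y ⟩
        Γ end Y ≈⟨ ∑-arrangements-↭ X↭Y _ ⟨
        Γ end X ∎

  -- Summation over all sign assignments

  -- Among the signings of S only the one that makes every letter small has nonzero weight, namely
  -- t^|S|. The sum over signings of the whole list thus leaves signs on R only. The function k is
  -- arbitrary since adding a letter to the list changes it in the induction.
  ∑-signings-splits : ∀ (X : List A) k →
    ∑[ Y ∈ signings X ] ∑[ (S , R) ∈ splits Y ] (t^small proj₁ S * k R) ≈
    ∑[ (S , R) ∈ splits X ] (t ^ length S * ∑ (signings R) k)
  ∑-signings-splits []      k = +-congʳ (≈-trans (+-identityʳ _) (*-congˡ (≈-sym (+-identityʳ _))))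
  ∑-signings-splits (x ∷ X) k = begin
    ∑[ Y ∈ signings (x ∷ X) ] ∑[ (S , R) ∈ splits Y ] (t^small proj₁ S * k R)
      ≈⟨ ∑-signings-∷ x X _ ⟩
    ∑[ Y ∈ signings X ] ((∑[ (S , R) ∈ splits (x⁻ ∷ Y) ] (t^small proj₁ S * k R)) +
                         (∑[ (S , R) ∈ splits (x⁺ ∷ Y) ] (t^small proj₁ S * k R)))
      ≈⟨ ∑-cong (signings X) (λ Y → ≈-trans (+-cong (∑-splits-∷ x⁻ Y _) (∑-splits-∷ x⁺ Y _))
           (≈-trans (≈-sym (∑-+ (splits Y) _ _)) (∑-cong (splits Y) λ (S , R) → collect _ _ _ _))) ⟩
    ∑[ Y ∈ signings X ] ∑[ (S , R) ∈ splits Y ] (t^small proj₁ S * (t * k R + (k (x⁻ ∷ R) + k (x⁺ ∷ R))))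
      ≈⟨ ∑-signings-splits X _ ⟩
    ∑[ (S , R) ∈ splits X ] (t ^ length S * (∑[ Y ∈ signings R ] (t * k Y + (k (x⁻ ∷ Y) + k (x⁺ ∷ Y)))))
      ≈⟨ ∑-cong (splits X) (λ (S , R) → begin
           t ^ length S * (∑[ Y ∈ signings R ] (t * k Y + (k (x⁻ ∷ Y) + k (x⁺ ∷ Y))))
             ≈⟨ *-congˡ (≈-trans (∑-+ (signings R) _ _) (+-cong (∑-*ˡ t (signings R) k) (≈-sym (∑-signings-∷ x R k)))) ⟩
           t ^ length S * (t * ∑ (signings R) k + ∑ (signings (x ∷ R)) k)
             ≈⟨ distribˡ _ _ _ ⟩
           t ^ length S * (t * ∑ (signings R) k) + t ^ length S * ∑ (signings (x ∷ R)) k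
             ≈⟨ +-congʳ (*.x∙yz≈yx∙z _ _ _) ⟩
           t * t ^ length S * ∑ (signings R) k + t ^ length S * ∑ (signings (x ∷ R)) k ∎) ⟩
    ∑[ (S , R) ∈ splits X ] (t ^ suc (length S) * ∑ (signings R) k + t ^ length S * ∑ (signings (x ∷ R)) k)
      ≈⟨ ∑-splits-∷ x X _ ⟨
    ∑[ (S , R) ∈ splits (x ∷ X) ] (t ^ length S * ∑ (signings R) k) ∎
    where
    x⁻ = (false , x)
    x⁺ = (true , x)

    collect : ∀ s a b c → ((t * s) * a + s * b) + ((0# * s) * a + s * c) ≈ s * (t * a + (b + c))
    collect s a b c = begin
      ((t * s) * a + s * b) + ((0# * s) * a + s * c)
        ≈⟨ +-congˡ (≈-trans (+-congʳ (≈-trans (*-congʳ (zeroˡ s)) (zeroˡ a))) (+-identityˡ _)) ⟩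
      ((t * s) * a + s * b) + s * c ≈⟨ +-assoc _ _ _ ⟩
      (t * s) * a + (s * b + s * c) ≈⟨ +-cong (*.xy∙z≈y∙xz t s a) (≈-sym (distribˡ s b c)) ⟩
      s * (t * a) + s * (b + c)     ≈⟨ distribˡ _ _ _ ⟨
      s * (t * a + (b + c))         ∎

  sorted : ∀ {n} {N P : List (Fin n)} → AllPairs Fin._<_ N → AllPairs Fin._<_ P →
    AllPairs (_≺_ descᴸ) (map (false ,_) N ++ map (true ,_) P)
  sorted <N <P = AllPairs.++⁺
    (AllPairs.map⁺ (AllPairs.map (λ x<y → <ᵇ-true x<y , <ᵇ-false (ℕ.<⇒≤ x<y)) <N))
    (AllPairs.map⁺ (AllPairs.map (λ x<y → <ᵇ-true x<y , <ᵇ-false (ℕ.<⇒≤ x<y)) <P))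
    (All.map⁺ (All.universal (λ _ → All.map⁺ (All.universal (λ _ → ≡.refl , ≡.refl) _)) _))

  proj₁-mono : ∀ {n} (x y : Letter n) → _≺_ descᴸ x y → proj₁ x ≡ true → proj₁ y ≡ true
  proj₁-mono (true , _) (true  , _) _        _ = ≡.refl
  proj₁-mono (true , _) (false , _) (() , _) _

  signedDes : ∀ {n} → List (Fin n) → K
  signedDes X = ∑[ w ∈ arrangements X ] ∑[ v ∈ signings w ] t^des (descents descᴸ proj₁ v)

  signedDes-map : ∀ {m n} (φ : Fin m → Fin n) → (∀ {x y} → x Fin.< y → φ x Fin.< φ y) →
    ∀ X → signedDes (map φ X) ≈ signedDes X
  signedDes-map φ mono X = ≈-trans (∑-arrangements-map φ X _) (∑-cong (arrangements X) λ w →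
    ≈-trans (∑-signings-map φ w _) (∑-cong (signings w) λ v →
      reflexive (≡.cong t^des (descents-map (map₂ φ) desc-φ (λ _ → ≡.refl) v))))
    where
    <ᵇ-φ : ∀ x y → (toℕ (φ y) <ᵇ toℕ (φ x)) ≡ (toℕ y <ᵇ toℕ x)
    <ᵇ-φ x y with y Fin.<? x
    ... | yes y<x = ≡.trans (<ᵇ-true (mono y<x)) (≡.sym (<ᵇ-true y<x))
    ... | no  y≮x with y Fin.≟ x
    ...   | yes ≡.refl = ≡.trans (<ᵇ-false {toℕ (φ x)} ℕ.≤-refl) (≡.sym (<ᵇ-false {toℕ x} ℕ.≤-refl))
    ...   | no  y≢x = ≡.trans (<ᵇ-false (ℕ.<⇒≤ (mono x<y))) (≡.sym (<ᵇ-false (ℕ.<⇒≤ x<y)))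
      where
      x<y : x Fin.< y
      x<y = ℕ.≤∧≢⇒< (ℕ.≮⇒≥ y≮x) (y≢x ∘ ≡.sym ∘ Fin.toℕ-injective)

    desc-φ : ∀ a b → descᴸ (map₂ φ a) (map₂ φ b) ≡ descᴸ a b
    desc-φ (false , x) (false , y) = <ᵇ-φ x y
    desc-φ (false , x) (true  , y) = ≡.refl
    desc-φ (true  , x) (false , y) = ≡.refl
    desc-φ (true  , x) (true  , y) = <ᵇ-φ x y

  -- With the signs moved outside the sums over words, the identity holds for each sign assignment
  -- separately, by `D̃es≈Γ` and the sorted form from `signings-sort`.
  binomial-γ : ∀ {n} {X : List (Fin n)} → AllPairs Fin._<_ X →
    ∑[ (S , R) ∈ splits X ] (t ^ length S * signedDes R) ≈
    ∑[ w ∈ arrangements X ] ∑[ v ∈ signings w ] γ-weight false (descents descᴸ proj₁ v)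
  binomial-γ {X = X} <X = begin
    ∑[ (S , R) ∈ splits X ] (t ^ length S * signedDes R)
      ≈⟨ ∑-cong (splits X) (λ (S , R) → *-congˡ (∑-arrangements-signings R _)) ⟩
    ∑[ (S , R) ∈ splits X ] (t ^ length S * ∑ (signings R) (Des descᴸ proj₁))
      ≈⟨ ∑-signings-splits X _ ⟨
    ∑ (signings X) (D̃es descᴸ proj₁ (λ {x} {y} → proj₁-mono x y))
      ≈⟨ ∑-congᴬ (All.map (λ (N , P , N⊆X , P⊆X , Y↭) →
           D̃es≈Γ descᴸ proj₁ (λ {x} {y} → proj₁-mono x y) Y↭
             (sorted (AllPairs-resp-⊆ N⊆X <X) (AllPairs-resp-⊆ P⊆X <X))) (signings-sort X)) ⟩
    ∑ (signings X) (Γ descᴸ proj₁)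
      ≈⟨ ∑-arrangements-signings X _ ⟨
    ∑[ w ∈ arrangements X ] ∑[ v ∈ signings w ] γ-weight false (descents descᴸ proj₁ v) ∎

-- Signed permutations as words of signed letters

open import Defs using
  ( [_⋯_]; words; unique?; permutations; SignedWord; signedPermutations; isDescent?; des; DesB
  ; NoConsecutive; noConsecutive?; ContainsLast; containsLast?; γ̃⁺; γ̃⁻ )

picks-⊆ : (X : List A) → All (λ (x , Y) → Y ⊆ X × suc (length Y) ≡ length X) (picks X)
picks-⊆ []      = []
picks-⊆ (x ∷ X) = (x ∷ʳ ⊆-refl , ≡.refl) ∷
  All.map⁺ (All.map (λ (Y⊆X , e) → ≡.refl ∷ Y⊆X , ≡.cong suc e) (picks-⊆ X))

lookup-mono : ∀ {n} {X : List (Fin n)} → AllPairs Fin._<_ X → ∀ {i j} → i Fin.< j → lookup X i Fin.< lookup X j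
lookup-mono (x<X ∷ _)  {Fin.zero}   {fsuc j} _       = All.lookup x<X (∈-lookup j)
lookup-mono (_   ∷ <X) {fsuc i}     {fsuc j} (s≤s l) = lookup-mono <X l

-- The map h is `id` for `des` and `not` for `DesB`, in which letters of opposite signs are small.
letters : ∀ {n k} → (Bool → Bool) → Vec (Fin n) k → Vec Bool k → List (Letter n)
letters h σ ε = toList (Vec.zipWith (λ e s → h e , s) ε σ)

-- The end letter has ε = 0 and σ = n + 1. It is therefore the largest letter with ε = 0 and lies
-- below all letters with ε = 1.
toList-descents : ∀ {n} (w : SignedWord n) →
  toList (Vec.tabulate (does ∘ isDescent? w)) ≡ descents descᴸ proj₁ (letters id (proj₁ w) (proj₂ w))
toList-descents {n} (σ , ε) = go σ ε
  where
  d : Bool → ℕ → Bool → ℕ → Bool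
  d e s e′ s′ = does ((e′ Bool.<? e) ⊎-dec ((e Bool.≟ e′) ×-dec (s′ ℕ.<? s)))

  last : ∀ e (x : Fin n) → d e (suc (toℕ x)) false (suc n) ≡ e
  last true  x = ≡.refl
  last false x = <ᵇ-false (ℕ.<⇒≤ (Fin.toℕ<n x))

  step : ∀ e (x : Fin n) e′ (y : Fin n) → d e (suc (toℕ x)) e′ (suc (toℕ y)) ≡ descᴸ (e , x) (e′ , y)
  step true  x true  y = ≡.refl
  step true  x false y = ≡.refl
  step false x true  y = ≡.refl
  step false x false y = ≡.refl

  -- The length k is independent of the bound n, since the tail of a permutation is only a word over
  -- the same letters.
  go : ∀ {k} (σ : Vec (Fin n) k) ε →
    let s = Vec.lookup (Vec.map (suc ∘ toℕ) σ Vec.∷ʳ suc n)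
        e = Vec.lookup (ε Vec.∷ʳ false)
    in toList (Vec.tabulate λ i → d (e (inject₁ i)) (s (inject₁ i)) (e (fsuc i)) (s (fsuc i))) ≡
       descents descᴸ proj₁ (letters id σ ε)
  go []          []          = ≡.refl
  go (x ∷ [])    (e ∷ [])    = ≡.cong (_∷ []) (last e x)
  go (x ∷ y ∷ σ) (e ∷ f ∷ ε) = ≡.cong₂ _∷_ (step e x f y) (go (y ∷ σ) (f ∷ ε))

-- Flipping the signs turns the order used by DesB into the one used by des.
toList-DesB : ∀ {n} (w : SignedWord n) →
  toList (DesB w) ≡ descents descᴸ proj₁ (letters not (proj₁ w) (proj₂ w))
toList-DesB {n} (σ , ε) = go σ ε
  where
  d : ℤ.ℤ → ℤ.ℤ → Bool
  d a b = does (((ℤ.0ℤ ℤ.<? a) ×-dec (b ℤ.<? a))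
    ⊎-dec (((a ℤ.<? ℤ.0ℤ) ×-dec (b ℤ.<? ℤ.0ℤ)) ×-dec (ℤ.∣ b ∣ ℕ.<? ℤ.∣ a ∣)))

  entry : Fin n → Bool → ℤ.ℤ
  entry s e = if e then ℤ.-[1+ toℕ s ] else ℤ.+ suc (toℕ s)

  -- Before the final 0 every positive entry is a descent, and no negative one is, since 0 is not
  -- negative.
  last : ∀ e (x : Fin n) → d (entry x e) ℤ.0ℤ ≡ not e
  last true  x = ≡.refl
  last false x = ≡.refl

  step : ∀ e (x : Fin n) f (y : Fin n) → d (entry x e) (entry y f) ≡ descᴸ (not e , x) (not f , y)
  step true  x true  y = ≡.refl
  step true  x false y = ≡.refl
  step false x true  y = ≡.refl
  step false x false y = Bool.∨-identityʳ _

  go : ∀ {k} (σ : Vec (Fin n) k) ε →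
    let w = Vec.lookup (Vec.zipWith entry σ ε Vec.∷ʳ ℤ.0ℤ)
    in toList (Vec.tabulate λ i → d (w (inject₁ i)) (w (fsuc i))) ≡ descents descᴸ proj₁ (letters not σ ε)
  go []          []          = ≡.refl
  go (x ∷ [])    (e ∷ [])    = ≡.cong (_∷ []) (last e x)
  go (x ∷ y ∷ σ) (e ∷ f ∷ ε) = ≡.cong₂ _∷_ (step e x f y) (go (y ∷ σ) (f ∷ ε))

-- From vectors of letters and signs to arrangements and signings

module WordSums (R : CommutativeSemiring 0ℓ 0ℓ) where
  open CommutativeSemiring R renaming (Carrier to K; refl to ≈-refl; sym to ≈-sym; trans to ≈-trans)
  open RawSemiringDefinitions rawSemiring using (_^_) renaming (_×_ to _·_)
  open SetoidReasoning setoid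
  open Sums R
  private module · = MonoidMult +-monoid

  ∑-words-avoiding : ∀ {m} (x : Fin m) xs k g →
    ∑[ w ∈ words xs k ] (if does (VecAll.all? (λ y → ¬? (x Fin.≟ y)) w) then g w else 0#) ≈
    ∑ (words (filter (λ y → ¬? (x Fin.≟ y)) xs) k) g
  ∑-words-avoiding x xs zero    g = ≈-refl
  ∑-words-avoiding x xs (suc k) g = begin
    ∑[ w ∈ words xs (suc k) ] (if does (VecAll.all? ≢x? w) then g w else 0#)
      ≈⟨ ∑-cartesianProductWith _∷_ xs (words xs k) _ ⟩
    ∑[ y ∈ xs ] ∑[ w ∈ words xs k ] (if does (≢x? y) ∧ does (VecAll.all? ≢x? w) then g (y ∷ w) else 0#)
      ≈⟨ ∑-cong xs (λ y → cases y (does (≢x? y))) ⟩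
    ∑[ y ∈ xs ] (if does (≢x? y) then (∑[ w ∈ words (filter ≢x? xs) k ] g (y ∷ w)) else 0#)
      ≈⟨ ∑-filter ≢x? xs _ ⟨
    ∑[ y ∈ filter ≢x? xs ] ∑[ w ∈ words (filter ≢x? xs) k ] g (y ∷ w)
      ≈⟨ ∑-cartesianProductWith _∷_ (filter ≢x? xs) (words (filter ≢x? xs) k) g ⟨
    ∑ (words (filter ≢x? xs) (suc k)) g ∎
    where
    ≢x? : ∀ y → Dec (x ≢ y)
    ≢x? y = ¬? (x Fin.≟ y)

    cases : ∀ y b →
      ∑[ w ∈ words xs k ] (if b ∧ does (VecAll.all? ≢x? w) then g (y ∷ w) else 0#) ≈
      (if b then (∑[ w ∈ words (filter ≢x? xs) k ] g (y ∷ w)) else 0#)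
    cases y true  = ∑-words-avoiding x xs k (g ∘ (y ∷_))
    cases y false = ∑-0 (words xs k)

  ∑-picks-filter : ∀ {m} {xs : List (Fin m)} → AllPairs _≢_ xs → (h : Fin m → List (Fin m) → K) →
    ∑[ x ∈ xs ] h x (filter (λ y → ¬? (x Fin.≟ y)) xs) ≈ ∑[ (x , Y) ∈ picks xs ] h x Y
  ∑-picks-filter []                       h = ≈-refl
  ∑-picks-filter {xs = x ∷ xs} (x∉xs ∷ !xs) h = begin
    h x (filter (≢? x) (x ∷ xs)) + (∑[ y ∈ xs ] h y (filter (≢? y) (x ∷ xs)))
      ≈⟨ +-cong
           (reflexive (≡.cong (h x) (≡.trans (filter-reject (≢? x) (λ x≢x → x≢x ≡.refl)) (filter-all (≢? x) x∉xs))))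
           (∑-congᴬ (All.map (λ {y} x≢y → reflexive (≡.cong (h y) (filter-accept (≢? y) (x≢y ∘ ≡.sym)))) x∉xs)) ⟩
    h x xs + (∑[ y ∈ xs ] h y (x ∷ filter (≢? y) xs))
      ≈⟨ +-congˡ (∑-picks-filter !xs (λ y Y → h y (x ∷ Y))) ⟩
    h x xs + (∑[ (y , Y) ∈ picks xs ] h y (x ∷ Y))
      ≡⟨ ∑-picks-∷ x xs _ ⟨
    ∑[ (y , Y) ∈ picks (x ∷ xs) ] h y Y ∎
    where
    ≢? : ∀ x y → Dec (x ≢ y)
    ≢? x y = ¬? (x Fin.≟ y)

  -- A word without repetitions whose length is that of `xs` uses each letter once. After its first
  -- letter x there remains such a word over `xs` without x.
  ∑-unique-words : ∀ {m} k {xs : List (Fin m)} → length xs ≡ k → AllPairs _≢_ xs → (f : List (Fin m) → K) →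
    ∑ (filter unique? (words xs k)) (f ∘ toList) ≈ ∑ (arrangements xs) f
  ∑-unique-words zero    {[]} _    _   f = ≈-refl
  ∑-unique-words (suc k) {xs@(_ ∷ _)} ∣xs∣ !xs f = begin
    ∑ (filter unique? (words xs (suc k))) (f ∘ toList)
      ≈⟨ ≈-trans (∑-filter unique? (words xs (suc k)) _) (∑-cartesianProductWith _∷_ xs (words xs k) _) ⟩
    ∑[ x ∈ xs ] ∑[ w ∈ words xs k ]
      (if does (VecAll.all? (≢? x) w) ∧ does (unique? w) then f (x ∷ toList w) else 0#)
      ≈⟨ ∑-cong xs (λ x → ∑-cong (words xs k) λ w → if-∧ (does (VecAll.all? (≢? x) w)) _ _) ⟩
    ∑[ x ∈ xs ] ∑[ w ∈ words xs k ]
      (if does (VecAll.all? (≢? x) w) then (if does (unique? w) then f (x ∷ toList w) else 0#) else 0#)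
      ≈⟨ ∑-cong xs (λ x → ≈-trans (∑-words-avoiding x xs k _) (≈-sym (∑-filter unique? (words (filter (≢? x) xs) k) _))) ⟩
    ∑[ x ∈ xs ] ∑[ w ∈ filter unique? (words (filter (≢? x) xs) k) ] f (x ∷ toList w)
      ≈⟨ ∑-picks-filter !xs (λ x Y → ∑[ w ∈ filter unique? (words Y k) ] f (x ∷ toList w)) ⟩
    ∑[ (x , Y) ∈ picks xs ] ∑[ w ∈ filter unique? (words Y k) ] f (x ∷ toList w)
      ≈⟨ ∑-congᴬ (All.map (λ {(x , Y)} (Y⊆xs , ∣Y∣) →
           ∑-unique-words k (ℕ.suc-injective (≡.trans ∣Y∣ ∣xs∣)) (AllPairs-resp-⊆ Y⊆xs !xs) (f ∘ (x ∷_))) (picks-⊆ xs)) ⟩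
    ∑[ (x , Y) ∈ picks xs ] ∑[ w ∈ arrangements Y ] f (x ∷ w)
      ≈⟨ ∑-arrangements-picks xs f′ ≈-refl ⟨
    ∑ (arrangements xs) f′
      ≈⟨ ∑-arrangements-cong xs (λ {w} → nonempty w) ⟩
    ∑ (arrangements xs) f ∎
    where
    ≢? : ∀ x y → Dec (x ≢ y)
    ≢? x y = ¬? (x Fin.≟ y)

    if-∧ : ∀ a b z → (if a ∧ b then z else 0#) ≈ (if a then (if b then z else 0#) else 0#)
    if-∧ true  b z = ≈-refl
    if-∧ false b z = ≈-refl

    -- Altered at `[]` to satisfy the hypothesis of `∑-arrangements-picks`; no arrangement of the
    -- nonempty `xs` is empty.
    f′ : List _ → K
    f′ []      = 0#
    f′ (x ∷ w) = f (x ∷ w)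

    nonempty : ∀ w → w ↭ xs → f′ w ≈ f w
    nonempty []      p with () ← null-↭ p
    nonempty (x ∷ w) p = ≈-refl

  -- The hypothesis on h expresses that h permutes `Bool`, in the form in which the sum needs it.
  ∑-signs : ∀ {n k} (h : Bool → Bool) → (∀ (g : Bool → K) → g (h false) + g (h true) ≈ g false + g true) →
    (σ : Vec (Fin n) k) (f : List (Letter n) → K) →
    ∑[ ε ∈ words (false ∷ true ∷ []) k ] f (letters h σ ε) ≈ ∑ (signings (toList σ)) f
  ∑-signs h inv []      f = ≈-refl
  ∑-signs {k = suc k} h inv (x ∷ σ) f = begin
    ∑[ ε ∈ words (false ∷ true ∷ []) (suc k) ] f (letters h (x ∷ σ) ε)
      ≈⟨ ∑-cartesianProductWith _∷_ (false ∷ true ∷ []) εs _ ⟩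
    (∑[ ε ∈ εs ] f ((h false , x) ∷ letters h σ ε)) + ((∑[ ε ∈ εs ] f ((h true , x) ∷ letters h σ ε)) + 0#)
      ≈⟨ ≈-trans (+-congˡ (+-identityʳ _)) (≈-sym (∑-+ εs _ _)) ⟩
    ∑[ ε ∈ εs ] (f ((h false , x) ∷ letters h σ ε) + f ((h true , x) ∷ letters h σ ε))
      ≈⟨ ∑-cong εs (λ ε → inv (λ b → f ((b , x) ∷ letters h σ ε))) ⟩
    ∑[ ε ∈ εs ] (f ((false , x) ∷ letters h σ ε) + f ((true , x) ∷ letters h σ ε))
      ≈⟨ ∑-signs h inv σ _ ⟩
    ∑[ v ∈ signings (toList σ) ] (f ((false , x) ∷ v) + f ((true , x) ∷ v))
      ≈⟨ ∑-signings-∷ x (toList σ) f ⟨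
    ∑ (signings (x ∷ toList σ)) f ∎
    where εs = words (false ∷ true ∷ []) k

  ∑-signedPermutations : ∀ n (h : Bool → Bool) → (∀ (g : Bool → K) → g (h false) + g (h true) ≈ g false + g true) →
    (f : List (Letter n) → K) →
    ∑[ (σ , ε) ∈ signedPermutations n ] f (letters h σ ε) ≈
    ∑[ w ∈ arrangements (allFin n) ] ∑ (signings w) f
  ∑-signedPermutations n h inv f = begin
    ∑[ (σ , ε) ∈ signedPermutations n ] f (letters h σ ε)
      ≈⟨ ∑-cartesianProductWith _,_ (permutations n) (words (false ∷ true ∷ []) n) _ ⟩
    ∑[ σ ∈ permutations n ] ∑[ ε ∈ words (false ∷ true ∷ []) n ] f (letters h σ ε)
      ≈⟨ ∑-cong (permutations n) (λ σ → ∑-signs h inv σ f) ⟩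
    ∑[ σ ∈ permutations n ] ∑ (signings (toList σ)) f
      ≈⟨ ∑-unique-words n (length-tabulate {n = n} id) (AllPairs.tabulate⁺ id) _ ⟩
    ∑[ w ∈ arrangements (allFin n) ] ∑ (signings w) f ∎

  module _ (t : K) where
    open Weights R t

    -- Only the relative order of the letters matters, so they may be renamed along the increasing
    -- map `lookup X`. Every sublist of length m thus contributes the same B_m.
    signedDes-⊆ : ∀ {n} {X : List (Fin n)} → X ⊆ allFin n → signedDes X ≈ signedDes (allFin (length X))
    signedDes-⊆ {n} {X} X⊆ = begin
      signedDes X
        ≡⟨ ≡.cong (signedDes) (≡.trans (map-tabulate {n = length X} id (lookup X)) (tabulate-lookup X)) ⟨
      signedDes (map (lookup X) (allFin (length X)))
        ≈⟨ signedDes-map (lookup X) (lookup-mono (AllPairs-resp-⊆ X⊆ (AllPairs.tabulate⁺-< id))) (allFin (length X)) ⟩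
      signedDes (allFin (length X)) ∎

    t^des-^ : ∀ {n} (S : Vec Bool n) → t^des (toList S) ≈ t ^ ∣ S ∣
    t^des-^ []          = ≈-refl
    t^des-^ (true  ∷ S) = *-congˡ (t^des-^ S)
    t^des-^ (false ∷ S) = ≈-trans (*-identityˡ _) (t^des-^ S)

    ∑-t^des : ∀ n → ∑[ w ∈ signedPermutations n ] t ^ des w ≈ signedDes (allFin n)
    ∑-t^des n = ≈-trans
      (∑-cong (signedPermutations n) λ w → ≈-trans (≈-sym (t^des-^ (Vec.tabulate (does ∘ isDescent? w))))
        (reflexive (≡.cong t^des (toList-descents w))))
      (∑-signedPermutations n id (λ g → ≈-refl) (t^des ∘ descents descᴸ proj₁))

    -- For the semiring of polynomials the left side is `B̃ n` by definition.
    ∑-γ-weight : ∀ n →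
      ∑[ m ∈ upTo (suc n) ] ((n C m) · (t ^ (n ∸ m) * (∑[ w ∈ signedPermutations m ] t ^ des w))) ≈
      ∑[ w ∈ signedPermutations n ] γ-weight false (toList (DesB w))
    ∑-γ-weight n = begin
      ∑[ m ∈ upTo (suc n) ] ((n C m) · (t ^ (n ∸ m) * (∑[ w ∈ signedPermutations m ] t ^ des w)))
        ≈⟨ ∑-cong (upTo (suc n)) (λ m → ·.×-congʳ (n C m) (*-congˡ (∑-t^des m))) ⟩
      ∑[ m ∈ upTo (suc n) ] ((n C m) · (t ^ (n ∸ m) * signedDes (allFin m)))
        ≡⟨ ≡.cong (λ k → ∑[ m ∈ upTo (suc k) ] ((k C m) · (t ^ (k ∸ m) * signedDes (allFin m)))) (length-tabulate {n = n} id) ⟨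
      ∑[ m ∈ upTo (suc (length (allFin n))) ] ((length (allFin n) C m) · (t ^ (length (allFin n) ∸ m) * signedDes (allFin m)))
        ≈⟨ ∑-splits-length (allFin n) (λ i j → t ^ i * signedDes (allFin j)) ⟨
      ∑[ (S , X) ∈ splits (allFin n) ] (t ^ length S * signedDes (allFin (length X)))
        ≈⟨ ∑-splits-cong (allFin n) (λ _ X⊆ → *-congˡ (signedDes-⊆ X⊆)) ⟨
      ∑[ (S , X) ∈ splits (allFin n) ] (t ^ length S * signedDes X)
        ≈⟨ binomial-γ {X = allFin n} (AllPairs.tabulate⁺-< id) ⟩
      ∑[ w ∈ arrangements (allFin n) ] ∑[ v ∈ signings w ] γ-weight false (descents descᴸ proj₁ v)
        -- Flipping all signs permutes the sign vectors, which passes from the order of `des` to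
        -- that of `DesB`.
        ≈⟨ ∑-signedPermutations n not (λ g → +-comm _ _) (γ-weight false ∘ descents descᴸ proj₁) ⟨
      ∑[ (σ , ε) ∈ signedPermutations n ] γ-weight false (descents descᴸ proj₁ (letters not σ ε))
        ≈⟨ ∑-cong (signedPermutations n) (λ w → reflexive (≡.cong (γ-weight false) (toList-DesB w))) ⟨
      ∑[ w ∈ signedPermutations n ] γ-weight false (toList (DesB w)) ∎

-- Sets without consecutive elements and their weights

private variable
  n : ℕ

noConsecutive-∷ : ∀ {b} {S : Subset n} → (∀ j → toℕ j ≡ 0 → ¬ (b ≡ true × j ∈ S)) →
  NoConsecutive S → NoConsecutive (b ∷ S)
noConsecutive-∷ h nc Fin.zero (fsuc j) e (here , there q)    = h j (ℕ.suc-injective e) (≡.refl , q)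
noConsecutive-∷ h nc (fsuc i) (fsuc j) e (there p , there q) = nc i j (ℕ.suc-injective e) (p , q)

noConsecutive-tail : ∀ {b} {S : Subset n} → NoConsecutive (b ∷ S) → NoConsecutive S
noConsecutive-tail nc i j e (p , q) = nc (fsuc i) (fsuc j) (≡.cong suc e) (there p , there q)

containsLast-∷ : ∀ {b} {S : Subset n} → ContainsLast S → ContainsLast (b ∷ S)
containsLast-∷ (i , e , p) = fsuc i , ≡.cong suc e , there p

containsLast-tail : ∀ {b} {S : Subset (suc n)} → ContainsLast (b ∷ S) → ContainsLast S
containsLast-tail (fsuc i , e , there p) = i , ℕ.suc-injective e , p

containsLast-outside : {S : Subset n} → ContainsLast (false ∷ S) → ContainsLast S
containsLast-outside (fsuc i , e , there p) = i , ℕ.suc-injective e , p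

containsLast⇒nonempty : {S : Subset n} → ContainsLast S → 1 ℕ.≤ ∣ S ∣
containsLast⇒nonempty {S = true  ∷ S} _                   = s≤s z≤n
containsLast⇒nonempty {S = false ∷ S} cl = containsLast⇒nonempty (containsLast-outside cl)

⌊/2⌋-≥ : ∀ i j {n} → j ℕ.+ 2 ℕ.* i ≡ n → i ℕ.≤ ⌊ n /2⌋
⌊/2⌋-≥ i j ≡.refl = ≡.subst (ℕ._≤ ⌊ j ℕ.+ 2 ℕ.* i /2⌋)
  (≡.trans (≡.cong (λ k → ⌊ i ℕ.+ k /2⌋) (ℕ.+-identityʳ i)) (≡.sym (ℕ.n≡⌊n+n/2⌋ i)))
  (ℕ.⌊n/2⌋-mono (ℕ.m≤n+m (2 ℕ.* i) j))

∸-2*-⌊/2⌋ : ∀ {i n} → i ℕ.≤ ⌊ n /2⌋ → n ∸ 2 ℕ.* i ℕ.+ 2 ℕ.* i ≡ n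
∸-2*-⌊/2⌋ {i} {n} i≤ = ℕ.m∸n+n≡m (begin
  2 ℕ.* i             ≤⟨ ℕ.*-monoʳ-≤ 2 i≤ ⟩
  2 ℕ.* ⌊ n /2⌋       ≡⟨ ≡.cong (⌊ n /2⌋ ℕ.+_) (ℕ.+-identityʳ ⌊ n /2⌋) ⟩
  ⌊ n /2⌋ ℕ.+ ⌊ n /2⌋ ≤⟨ ℕ.+-monoʳ-≤ ⌊ n /2⌋ (ℕ.⌊n/2⌋≤⌈n/2⌉ n) ⟩
  ⌊ n /2⌋ ℕ.+ ℕ.⌈ n /2⌉ ≡⟨ ℕ.⌊n/2⌋+⌈n/2⌉≡n n ⟩
  n ∎)
  where open ℕ.≤-Reasoning

+2*-suc : ∀ j i {n} → j ℕ.+ 2 ℕ.* i ≡ n → j ℕ.+ 2 ℕ.* suc i ≡ 2 ℕ.+ n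
+2*-suc j i ≡.refl = ≡.trans (≡.cong (j ℕ.+_) (ℕ.*-suc 2 i)) (≡.trans (≡.sym (ℕ.+-assoc j 2 _))
  (≡.trans (≡.cong (ℕ._+ 2 ℕ.* i) (ℕ.+-comm j 2)) (ℕ.+-assoc 2 j _)))

module GammaSums (R : CommutativeSemiring 0ℓ 0ℓ) (t : CommutativeSemiring.Carrier R) where
  open CommutativeSemiring R renaming (Carrier to K; refl to ≈-refl; sym to ≈-sym; trans to ≈-trans)
  open RawSemiringDefinitions rawSemiring using (_^_) renaming (_×_ to _·_)
  open SetoidReasoning setoid
  open Sums R
  open Weights R t
  private module * = CommutativeSemigroupProperties *-commutativeSemigroup

  -- Each descent takes up two positions, itself and the next one, and the other j positions have
  -- weight 1 + t. If n is a descent, its successor is the position n + 1 outside the word, whence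
  -- `suc n` in place of `n`.
  data Shape : ∀ {n} → Subset n → Set where
    without-last : ∀ {S : Subset n} j → NoConsecutive S → ¬ ContainsLast S → j ℕ.+ 2 ℕ.* ∣ S ∣ ≡ n →
      γ-weight false (toList S) ≈ t ^ ∣ S ∣ * (1# + t) ^ j → Shape S
    with-last : ∀ {S : Subset n} j → NoConsecutive S → ContainsLast S → j ℕ.+ 2 ℕ.* ∣ S ∣ ≡ suc n →
      γ-weight false (toList S) ≈ t ^ ∣ S ∣ * (1# + t) ^ j → Shape S
    consecutive : ∀ {S : Subset n} → ¬ NoConsecutive S → γ-weight false (toList S) ≈ 0# → Shape S

  shape : (S : Subset n) → Shape S
  shape []          = without-last 0 (λ ()) (λ ()) ≡.refl (≈-sym (*-identityˡ 1#))
  shape (false ∷ S) with shape S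
  ... | without-last j nc cl e w = without-last (suc j) (noConsecutive-∷ (λ _ _ ()) nc) (cl ∘ containsLast-outside)
    (≡.cong suc e) (≈-trans (*-congˡ w) (*.x∙yz≈y∙xz _ _ _))
  ... | with-last j nc cl e w = with-last (suc j) (noConsecutive-∷ (λ _ _ ()) nc) (containsLast-∷ cl)
    (≡.cong suc e) (≈-trans (*-congˡ w) (*.x∙yz≈y∙xz _ _ _))
  ... | consecutive ¬nc w = consecutive (¬nc ∘ noConsecutive-tail) (≈-trans (*-congˡ w) (zeroʳ _))
  shape (true ∷ [])         = with-last 0 (noConsecutive-∷ (λ ()) λ ()) (Fin.zero , ≡.refl , here) ≡.refl
    (≈-sym (*-identityʳ _))
  shape (true ∷ true  ∷ S)  = consecutive (λ nc → nc Fin.zero (fsuc Fin.zero) ≡.refl (here , there here)) (zeroʳ t)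
  shape (true ∷ false ∷ S) with shape S
  ... | without-last j nc cl e w = without-last j
    (noConsecutive-∷ (λ { Fin.zero _ (_ , ()) }) (noConsecutive-∷ (λ _ _ ()) nc))
    (cl ∘ containsLast-outside ∘ containsLast-tail)
    (+2*-suc j ∣ S ∣ e) (≈-trans (*-congˡ w) (≈-sym (*-assoc _ _ _)))
  ... | with-last j nc cl e w = with-last j
    (noConsecutive-∷ (λ { Fin.zero _ (_ , ()) }) (noConsecutive-∷ (λ _ _ ()) nc))
    (containsLast-∷ (containsLast-∷ cl))
    (+2*-suc j ∣ S ∣ e) (≈-trans (*-congˡ w) (≈-sym (*-assoc _ _ _)))
  ... | consecutive ¬nc w = consecutive (¬nc ∘ noConsecutive-tail ∘ noConsecutive-tail) (≈-trans (*-congˡ w) (zeroʳ _))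

  length-filter-· : ∀ {P : A → Set} (P? : ∀ x → Dec (P x)) xs p →
    length (filter P? xs) · p ≈ ∑[ x ∈ xs ] (if does (P? x) then p else 0#)
  length-filter-· P? []       p = ≈-refl
  length-filter-· P? (x ∷ xs) p with does (P? x)
  ... | true  = +-congˡ (length-filter-· P? xs p)
  ... | false = ≈-trans (length-filter-· P? xs p) (≈-sym (+-identityˡ _))

  ∑-upTo-select : ∀ k d (p : ℕ → K) → d ℕ.< k → ∑[ i ∈ upTo k ] (if does (d ℕ.≟ i) then p i else 0#) ≈ p d
  ∑-upTo-select (suc k) zero    p _       = ≈-trans (reflexive (∑-upTo-suc k _))
    (≈-trans (+-congˡ (∑-0 (upTo k))) (+-identityʳ _))
  ∑-upTo-select (suc k) (suc d) p (s≤s l) = ≈-trans (reflexive (∑-upTo-suc k _))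
    (≈-trans (+-identityˡ _) (∑-upTo-select k d (p ∘ suc) l))

  ∑-select₀ : ∀ m d (p : ℕ → K) → d ℕ.≤ m → ∑[ i ∈ [ 0 ⋯ m ] ] (if does (d ℕ.≟ i) then p i else 0#) ≈ p d
  ∑-select₀ m d p d≤m = ∑-upTo-select (suc m) d p (s≤s d≤m)

  ∑-select₁ : ∀ m d (p : ℕ → K) → 1 ℕ.≤ d → d ℕ.≤ m →
    ∑[ i ∈ [ 1 ⋯ m ] ] (if does (d ℕ.≟ i) then p i else 0#) ≈ p d
  ∑-select₁ m (suc d) p _ d<m = ≈-trans
    (reflexive (≡.trans (≡.cong (λ xs → ∑ xs _) (≡.sym (map-upTo suc m))) (∑-map suc (upTo m) _)))
    (∑-upTo-select m d (p ∘ suc) d<m)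

  ∑-if-true : ∀ (I : List ℕ) d {b} → b ≡ true → (p : ℕ → K) →
    ∑[ i ∈ I ] (if does (d ℕ.≟ i) ∧ b then p i else 0#) ≈ ∑[ i ∈ I ] (if does (d ℕ.≟ i) then p i else 0#)
  ∑-if-true I d ≡.refl p = ∑-cong I λ i → reflexive (≡.cong (if_then p i else 0#) (Bool.∧-identityʳ (does (d ℕ.≟ i))))

  ∑-if-false : ∀ (I : List ℕ) d {b} → b ≡ false → (p : ℕ → K) →
    ∑[ i ∈ I ] (if does (d ℕ.≟ i) ∧ b then p i else 0#) ≈ 0#
  ∑-if-false I d ≡.refl p = ≈-trans
    (∑-cong I λ i → reflexive (≡.cong (if_then p i else 0#) (Bool.∧-zeroʳ (does (d ℕ.≟ i))))) (∑-0 I)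

  γ⁺-sum γ⁻-sum : ℕ → K
  γ⁺-sum n = ∑[ i ∈ [ 0 ⋯ ⌊ n /2⌋ ] ] γ̃⁺ n i · (t ^ i * (1# + t) ^ (n ∸ 2 ℕ.* i))
  γ⁻-sum n = ∑[ i ∈ [ 1 ⋯ ⌊ suc n /2⌋ ] ] γ̃⁻ n i · (t ^ i * (1# + t) ^ (suc n ∸ 2 ℕ.* i))

  exponent : ∀ i j {m} → j ℕ.+ 2 ℕ.* i ≡ m → m ∸ 2 ℕ.* i ≡ j
  exponent i j ≡.refl = ℕ.m+n∸n≡m j (2 ℕ.* i)

  -- After exchanging the sums, a signed permutation with sparse descent set contributes to a single
  -- index i, the size of that set, in exactly one of the two sums.
  γ-sums : ∀ n → γ⁺-sum n + γ⁻-sum n ≈ ∑[ w ∈ signedPermutations n ] γ-weight false (toList (DesB w))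
  γ-sums n = begin
    γ⁺-sum n + γ⁻-sum n
      ≈⟨ +-cong
           (≈-trans (∑-cong I⁺ λ i → length-filter-· _ ws (p⁺ i)) (∑-swap I⁺ ws _))
           (≈-trans (∑-cong I⁻ λ i → length-filter-· _ ws (p⁻ i)) (∑-swap I⁻ ws _)) ⟩
    (∑[ w ∈ ws ] term⁺ (DesB w)) + (∑[ w ∈ ws ] term⁻ (DesB w))
      ≈⟨ ∑-+ ws _ _ ⟨
    ∑[ w ∈ ws ] (term⁺ (DesB w) + term⁻ (DesB w))
      ≈⟨ ∑-cong ws (λ w → terms (DesB w) (shape (DesB w))) ⟩
    ∑[ w ∈ ws ] γ-weight false (toList (DesB w)) ∎
    where
    ws = signedPermutations n
    I⁺ = [ 0 ⋯ ⌊ n /2⌋ ]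
    I⁻ = [ 1 ⋯ ⌊ suc n /2⌋ ]

    p⁺ p⁻ : ℕ → K
    p⁺ i = t ^ i * (1# + t) ^ (n ∸ 2 ℕ.* i)
    p⁻ i = t ^ i * (1# + t) ^ (suc n ∸ 2 ℕ.* i)

    term⁺ term⁻ : Subset n → K
    term⁺ S = ∑[ i ∈ I⁺ ] (if does ((∣ S ∣ ℕ.≟ i) ×-dec noConsecutive? S ×-dec ¬? (containsLast? S)) then p⁺ i else 0#)
    term⁻ S = ∑[ i ∈ I⁻ ] (if does ((∣ S ∣ ℕ.≟ i) ×-dec noConsecutive? S ×-dec containsLast? S) then p⁻ i else 0#)

    terms : ∀ S → Shape S → term⁺ S + term⁻ S ≈ γ-weight false (toList S)
    terms S (without-last j nc ¬cl e w) = begin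
      term⁺ S + term⁻ S
        ≈⟨ +-cong
             (≈-trans (∑-if-true I⁺ ∣ S ∣ (dec-true (noConsecutive? S ×-dec ¬? (containsLast? S)) (nc , ¬cl)) p⁺)
                      (∑-select₀ _ ∣ S ∣ p⁺ (⌊/2⌋-≥ ∣ S ∣ j e)))
             (∑-if-false I⁻ ∣ S ∣ (dec-false (noConsecutive? S ×-dec containsLast? S) (¬cl ∘ proj₂)) p⁻) ⟩
      p⁺ ∣ S ∣ + 0#
        ≈⟨ +-identityʳ _ ⟩
      p⁺ ∣ S ∣
        ≡⟨ ≡.cong (λ k → t ^ ∣ S ∣ * (1# + t) ^ k) (exponent ∣ S ∣ j e) ⟩
      t ^ ∣ S ∣ * (1# + t) ^ j
        ≈⟨ w ⟨
      γ-weight false (toList S) ∎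
    terms S (with-last j nc cl e w) = begin
      term⁺ S + term⁻ S
        ≈⟨ +-cong
             (∑-if-false I⁺ ∣ S ∣ (dec-false (noConsecutive? S ×-dec ¬? (containsLast? S)) (λ (_ , ¬cl) → ¬cl cl)) p⁺)
             (≈-trans (∑-if-true I⁻ ∣ S ∣ (dec-true (noConsecutive? S ×-dec containsLast? S) (nc , cl)) p⁻)
                      -- The index 0 is missing from `I⁻`, but a set that contains n is not empty.
                      (∑-select₁ _ ∣ S ∣ p⁻ (containsLast⇒nonempty cl) (⌊/2⌋-≥ ∣ S ∣ j e))) ⟩
      0# + p⁻ ∣ S ∣
        ≈⟨ +-identityˡ _ ⟩
      p⁻ ∣ S ∣
        ≡⟨ ≡.cong (λ k → t ^ ∣ S ∣ * (1# + t) ^ k) (exponent ∣ S ∣ j e) ⟩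
      t ^ ∣ S ∣ * (1# + t) ^ j
        ≈⟨ w ⟨
      γ-weight false (toList S) ∎
    terms S (consecutive ¬nc w) = ≈-trans
      (+-cong (∑-if-false I⁺ ∣ S ∣ (dec-false (noConsecutive? S ×-dec ¬? (containsLast? S)) (¬nc ∘ proj₁)) p⁺)
              (∑-if-false I⁻ ∣ S ∣ (dec-false (noConsecutive? S ×-dec containsLast? S) (¬nc ∘ proj₁)) p⁻))
      (≈-trans (+-identityˡ 0#) (≈-sym w))

-- The commutative semiring of integer polynomials

open import Data.Integer.Base using (ℤ; +_; -[1+_]; 0ℤ; 1ℤ)
open import Defs
open ≡-Reasoning

≈-isEquivalence : IsEquivalence _≈_
≈-isEquivalence = record
  { refl  = λ k → ≡.refl
  ; sym   = λ e k → ≡.sym (e k)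
  ; trans = λ e f k → ≡.trans (e k) (f k)
  }

+-cong : ∀ p p′ q q′ → p ≈ p′ → q ≈ q′ → p + q ≈ p′ + q′
+-cong p p′ q q′ e f k = begin
  coeff (p + q) k              ≡⟨ coeff-+ p q k ⟩
  coeff p k ℤ.+ coeff q k      ≡⟨ ≡.cong₂ ℤ._+_ (e k) (f k) ⟩
  coeff p′ k ℤ.+ coeff q′ k    ≡⟨ coeff-+ p′ q′ k ⟨
  coeff (p′ + q′) k            ∎

+-comm : ∀ p q → p + q ≈ q + p
+-comm p q k = begin
  coeff (p + q) k         ≡⟨ coeff-+ p q k ⟩
  coeff p k ℤ.+ coeff q k ≡⟨ ℤ.+-comm (coeff p k) (coeff q k) ⟩
  coeff q k ℤ.+ coeff p k ≡⟨ coeff-+ q p k ⟨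
  coeff (q + p) k         ∎

+-assoc : ∀ p q r → (p + q) + r ≈ p + (q + r)
+-assoc p q r k = begin
  coeff ((p + q) + r) k                         ≡⟨ coeff-+ (p + q) r k ⟩
  coeff (p + q) k ℤ.+ coeff r k                 ≡⟨ ≡.cong (ℤ._+ coeff r k) (coeff-+ p q k) ⟩
  coeff p k ℤ.+ coeff q k ℤ.+ coeff r k         ≡⟨ ℤ.+-assoc (coeff p k) (coeff q k) (coeff r k) ⟩
  coeff p k ℤ.+ (coeff q k ℤ.+ coeff r k)       ≡⟨ ≡.cong (λ x → coeff p k ℤ.+ x) (coeff-+ q r k) ⟨
  coeff p k ℤ.+ coeff (q + r) k                 ≡⟨ coeff-+ p (q + r) k ⟨
  coeff (p + (q + r)) k                         ∎

∷-cong : ∀ {a p q} → p ≈ q → (a ∷ p) ≈ (a ∷ q)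
∷-cong e zero    = ≡.refl
∷-cong e (suc k) = e k

coeff-scale : ∀ a p k → coeff (map (a ℤ.*_) p) k ≡ a ℤ.* coeff p k
coeff-scale a []      k       = ≡.sym (ℤ.*-zeroʳ a)
coeff-scale a (b ∷ p) zero    = ≡.refl
coeff-scale a (b ∷ p) (suc k) = coeff-scale a p k

coeff-∷* : ∀ a p q k → coeff ((a ∷ p) * q) k ≡ a ℤ.* coeff q k ℤ.+ coeff (0ℤ ∷ p * q) k
coeff-∷* a p q k = ≡.trans (coeff-+ (map (a ℤ.*_) q) _ k) (≡.cong (ℤ._+ coeff (0ℤ ∷ p * q) k) (coeff-scale a q k))

*-congˡ : ∀ p {q r} → q ≈ r → p * q ≈ p * r
*-congˡ []      e k = ≡.refl
*-congˡ (a ∷ p) {q} {r} e k = begin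
  coeff ((a ∷ p) * q) k                         ≡⟨ coeff-∷* a p q k ⟩
  a ℤ.* coeff q k ℤ.+ coeff (0ℤ ∷ p * q) k      ≡⟨ ≡.cong₂ (λ x y → a ℤ.* x ℤ.+ y) (e k) (∷-cong (*-congˡ p e) k) ⟩
  a ℤ.* coeff r k ℤ.+ coeff (0ℤ ∷ p * r) k      ≡⟨ coeff-∷* a p r k ⟨
  coeff ((a ∷ p) * r) k                         ∎

*-zeroʳ : ∀ p → p * [] ≈ []
*-zeroʳ []      k       = ≡.refl
*-zeroʳ (a ∷ p) zero    = ≡.refl
*-zeroʳ (a ∷ p) (suc k) = *-zeroʳ p k

-- The mirror image of the recursion that defines `_*_`; it reduces commutativity to an induction on
-- one factor.
*-∷ : ∀ p b q → p * (b ∷ q) ≈ map (b ℤ.*_) p + (0ℤ ∷ p * q)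
*-∷ []      b q zero    = ≡.refl
*-∷ []      b q (suc k) = ≡.refl
*-∷ (a ∷ p) b q zero    = ≡.cong (ℤ._+ 0ℤ) (ℤ.*-comm a b)
*-∷ (a ∷ p) b q (suc k) = begin
  coeff (map (a ℤ.*_) q + p * (b ∷ q)) k
    ≡⟨ coeff-+ (map (a ℤ.*_) q) _ k ⟩
  coeff (map (a ℤ.*_) q) k ℤ.+ coeff (p * (b ∷ q)) k
    ≡⟨ ≡.cong (λ x → coeff (map (a ℤ.*_) q) k ℤ.+ x) (≡.trans (*-∷ p b q k) (coeff-+ (map (b ℤ.*_) p) _ k)) ⟩
  coeff (map (a ℤ.*_) q) k ℤ.+ (coeff (map (b ℤ.*_) p) k ℤ.+ coeff (0ℤ ∷ p * q) k)
    ≡⟨ exchange (coeff (map (a ℤ.*_) q) k) (coeff (map (b ℤ.*_) p) k) (coeff (0ℤ ∷ p * q) k) ⟩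
  coeff (map (b ℤ.*_) p) k ℤ.+ (coeff (map (a ℤ.*_) q) k ℤ.+ coeff (0ℤ ∷ p * q) k)
    ≡⟨ ≡.cong (λ x → coeff (map (b ℤ.*_) p) k ℤ.+ x) (coeff-+ (map (a ℤ.*_) q) _ k) ⟨
  coeff (map (b ℤ.*_) p) k ℤ.+ coeff ((a ∷ p) * q) k
    ≡⟨ coeff-+ (map (b ℤ.*_) p) _ k ⟨
  coeff (map (b ℤ.*_) p + (a ∷ p) * q) k ∎
  where
  exchange : ∀ x y z → x ℤ.+ (y ℤ.+ z) ≡ y ℤ.+ (x ℤ.+ z)
  exchange = solve-∀

*-comm : ∀ p q → p * q ≈ q * p
*-comm []      q k = ≡.sym (*-zeroʳ q k)
*-comm (a ∷ p) q k = ≡.trans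
  (+-cong (map (a ℤ.*_) q) (map (a ℤ.*_) q) (0ℤ ∷ p * q) (0ℤ ∷ q * p) (λ _ → ≡.refl) (∷-cong (*-comm p q)) k)
  (≡.sym (*-∷ q a p k))

*-cong : ∀ {p p′ q q′} → p ≈ p′ → q ≈ q′ → p * q ≈ p′ * q′
*-cong {p} {p′} {q} {q′} e f k = begin
  coeff (p * q) k   ≡⟨ *-congˡ p f k ⟩
  coeff (p * q′) k  ≡⟨ *-comm p q′ k ⟩
  coeff (q′ * p) k  ≡⟨ *-congˡ q′ e k ⟩
  coeff (q′ * p′) k ≡⟨ *-comm q′ p′ k ⟩
  coeff (p′ * q′) k ∎

*-distribˡ-+ : ∀ p q r → p * (q + r) ≈ p * q + p * r
*-distribˡ-+ []      q r k = ≡.refl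
*-distribˡ-+ (a ∷ p) q r k = begin
  coeff ((a ∷ p) * (q + r)) k
    ≡⟨ coeff-∷* a p (q + r) k ⟩
  a ℤ.* coeff (q + r) k ℤ.+ coeff (0ℤ ∷ p * (q + r)) k
    ≡⟨ ≡.cong₂ (λ x y → a ℤ.* x ℤ.+ y) (coeff-+ q r k)
         (≡.trans (∷-cong (*-distribˡ-+ p q r) k) (coeff-+ (0ℤ ∷ p * q) (0ℤ ∷ p * r) k)) ⟩
  a ℤ.* (coeff q k ℤ.+ coeff r k) ℤ.+ (coeff (0ℤ ∷ p * q) k ℤ.+ coeff (0ℤ ∷ p * r) k)
    ≡⟨ distribute a (coeff q k) (coeff r k) _ _ ⟩
  (a ℤ.* coeff q k ℤ.+ coeff (0ℤ ∷ p * q) k) ℤ.+ (a ℤ.* coeff r k ℤ.+ coeff (0ℤ ∷ p * r) k)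
    ≡⟨ ≡.cong₂ ℤ._+_ (coeff-∷* a p q k) (coeff-∷* a p r k) ⟨
  coeff ((a ∷ p) * q) k ℤ.+ coeff ((a ∷ p) * r) k
    ≡⟨ coeff-+ ((a ∷ p) * q) _ k ⟨
  coeff ((a ∷ p) * q + (a ∷ p) * r) k ∎
  where
  distribute : ∀ a x y u v → a ℤ.* (x ℤ.+ y) ℤ.+ (u ℤ.+ v) ≡ (a ℤ.* x ℤ.+ u) ℤ.+ (a ℤ.* y ℤ.+ v)
  distribute = solve-∀

*-distribʳ-+ : ∀ p q r → (q + r) * p ≈ q * p + r * p
*-distribʳ-+ p q r k = begin
  coeff ((q + r) * p) k   ≡⟨ *-comm (q + r) p k ⟩
  coeff (p * (q + r)) k   ≡⟨ *-distribˡ-+ p q r k ⟩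
  coeff (p * q + p * r) k ≡⟨ +-cong (p * q) (q * p) (p * r) (r * p) (*-comm p q) (*-comm p r) k ⟩
  coeff (q * p + r * p) k ∎

scale-* : ∀ a p q → map (a ℤ.*_) p * q ≈ map (a ℤ.*_) (p * q)
scale-* a []      q k = ≡.refl
scale-* a (b ∷ p) q k = begin
  coeff (map (a ℤ.*_) (b ∷ p) * q) k
    ≡⟨ coeff-∷* (a ℤ.* b) (map (a ℤ.*_) p) q k ⟩
  a ℤ.* b ℤ.* coeff q k ℤ.+ coeff (0ℤ ∷ map (a ℤ.*_) p * q) k
    ≡⟨ ≡.cong (λ x → a ℤ.* b ℤ.* coeff q k ℤ.+ x) (tail k) ⟩
  a ℤ.* b ℤ.* coeff q k ℤ.+ a ℤ.* coeff (0ℤ ∷ p * q) k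
    ≡⟨ factor a b (coeff q k) _ ⟩
  a ℤ.* (b ℤ.* coeff q k ℤ.+ coeff (0ℤ ∷ p * q) k)
    ≡⟨ ≡.cong (λ x → a ℤ.* x) (coeff-∷* b p q k) ⟨
  a ℤ.* coeff ((b ∷ p) * q) k
    ≡⟨ coeff-scale a ((b ∷ p) * q) k ⟨
  coeff (map (a ℤ.*_) ((b ∷ p) * q)) k ∎
  where
  factor : ∀ a b x y → a ℤ.* b ℤ.* x ℤ.+ a ℤ.* y ≡ a ℤ.* (b ℤ.* x ℤ.+ y)
  factor = solve-∀

  tail : ∀ k → coeff (0ℤ ∷ map (a ℤ.*_) p * q) k ≡ a ℤ.* coeff (0ℤ ∷ p * q) k
  tail zero    = ≡.sym (ℤ.*-zeroʳ a)
  tail (suc k) = ≡.trans (scale-* a p q k) (coeff-scale a (p * q) k)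

0∷-* : ∀ p q → (0ℤ ∷ p) * q ≈ (0ℤ ∷ p * q)
0∷-* p q k = ≡.trans (coeff-∷* 0ℤ p q k) (ℤ.+-identityˡ _)

*-assoc : ∀ p q r → (p * q) * r ≈ p * (q * r)
*-assoc []      q r k = ≡.refl
*-assoc (a ∷ p) q r k = begin
  coeff ((map (a ℤ.*_) q + (0ℤ ∷ p * q)) * r) k
    ≡⟨ *-distribʳ-+ r (map (a ℤ.*_) q) (0ℤ ∷ p * q) k ⟩
  coeff (map (a ℤ.*_) q * r + (0ℤ ∷ p * q) * r) k
    ≡⟨ +-cong (map (a ℤ.*_) q * r) (map (a ℤ.*_) (q * r)) ((0ℤ ∷ p * q) * r) (0ℤ ∷ (p * q) * r)
         (scale-* a q r) (0∷-* (p * q) r) k ⟩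
  coeff (map (a ℤ.*_) (q * r) + (0ℤ ∷ (p * q) * r)) k
    ≡⟨ +-cong (map (a ℤ.*_) (q * r)) (map (a ℤ.*_) (q * r)) (0ℤ ∷ (p * q) * r) (0ℤ ∷ p * (q * r))
         (λ _ → ≡.refl) (∷-cong (*-assoc p q r)) k ⟩
  coeff (map (a ℤ.*_) (q * r) + (0ℤ ∷ p * (q * r))) k ∎

*-identityˡ : ∀ p → 1ᴾ * p ≈ p
*-identityˡ p k = begin
  coeff (1ᴾ * p) k                      ≡⟨ coeff-∷* 1ℤ [] p k ⟩
  1ℤ ℤ.* coeff p k ℤ.+ coeff (0ℤ ∷ []) k ≡⟨ ≡.cong₂ ℤ._+_ (ℤ.*-identityˡ (coeff p k)) (zero-tail k) ⟩
  coeff p k ℤ.+ 0ℤ                      ≡⟨ ℤ.+-identityʳ _ ⟩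
  coeff p k                             ∎
  where
  zero-tail : ∀ k → coeff (0ℤ ∷ []) k ≡ 0ℤ
  zero-tail zero    = ≡.refl
  zero-tail (suc k) = ≡.refl

polyCommutativeSemiring : CommutativeSemiring 0ℓ 0ℓ
polyCommutativeSemiring = record
  { Carrier = Poly ; _≈_ = _≈_ ; _+_ = _+_ ; _*_ = _*_ ; 0# = 0ᴾ ; 1# = 1ᴾ
  ; isCommutativeSemiring = isCommutativeSemiringˡ record
    { +-isCommutativeMonoid = isCommutativeMonoidˡ record
      { isSemigroup = record
        { isMagma = record
          { isEquivalence = ≈-isEquivalence
          ; ∙-cong = λ {p} {p′} {q} {q′} → +-cong p p′ q q′ }
        ; assoc = +-assoc }
      ; identityˡ = λ p k → ≡.refl
      ; comm = +-comm }
    ; *-isCommutativeMonoid = isCommutativeMonoidˡ record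
      { isSemigroup = record
        { isMagma = record
          { isEquivalence = ≈-isEquivalence
          ; ∙-cong = λ {p} {p′} {q} {q′} → *-cong {p} {p′} {q} {q′} }
        ; assoc = *-assoc }
      ; identityˡ = *-identityˡ
      ; comm = *-comm }
    ; distribʳ = *-distribʳ-+
    ; zeroˡ = λ p k → ≡.refl
    }
  }

-- Palindromic polynomials

coeffᶻ-cong : ∀ {p q} → p ≈ q → ∀ k → coeffᶻ p k ≡ coeffᶻ q k
coeffᶻ-cong e (+ k)    = e k
coeffᶻ-cong e -[1+ k ] = ≡.refl

coeffᶻ-+ : ∀ p q k → coeffᶻ (p + q) k ≡ coeffᶻ p k ℤ.+ coeffᶻ q k
coeffᶻ-+ p q (+ k)    = coeff-+ p q k
coeffᶻ-+ p q -[1+ k ] = ≡.refl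

-- With integer exponents, multiplication by t is a shift that needs no exception at the constant
-- term.
coeffᶻ-t* : ∀ p k → coeffᶻ (t * p) k ≡ coeffᶻ p (ℤ.pred k)
coeffᶻ-t* p (+ zero)  = 0∷-* 1ᴾ p 0
coeffᶻ-t* p (+ suc k) = ≡.trans (0∷-* 1ᴾ p (suc k)) (*-identityˡ p k)
coeffᶻ-t* p -[1+ k ]  = ≡.refl

palindromic-cong : ∀ {d p q} → p ≈ q → Palindromic d p → Palindromic d q
palindromic-cong {d} {p} {q} e pal k = begin
  coeffᶻ q (+ d ℤ.- k) ≡⟨ coeffᶻ-cong {p} e (+ d ℤ.- k) ⟨
  coeffᶻ p (+ d ℤ.- k) ≡⟨ pal k ⟩
  coeffᶻ p k           ≡⟨ coeffᶻ-cong {p} e k ⟩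
  coeffᶻ q k           ∎

palindromic-0 : ∀ d → Palindromic d 0ᴾ
palindromic-0 d k = ≡.trans (zero-coeff (+ d ℤ.- k)) (≡.sym (zero-coeff k))
  where
  zero-coeff : ∀ k → coeffᶻ 0ᴾ k ≡ 0ℤ
  zero-coeff (+ k)    = ≡.refl
  zero-coeff -[1+ k ] = ≡.refl

palindromic-1 : Palindromic 0 1ᴾ
palindromic-1 (+ zero)  = ≡.refl
palindromic-1 (+ suc k) = ≡.refl
palindromic-1 -[1+ k ]  = ≡.refl

palindromic-+ : ∀ {d} p q → Palindromic d p → Palindromic d q → Palindromic d (p + q)
palindromic-+ {d} p q pal-p pal-q k = begin
  coeffᶻ (p + q) (+ d ℤ.- k)                        ≡⟨ coeffᶻ-+ p q (+ d ℤ.- k) ⟩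
  coeffᶻ p (+ d ℤ.- k) ℤ.+ coeffᶻ q (+ d ℤ.- k)     ≡⟨ ≡.cong₂ ℤ._+_ (pal-p k) (pal-q k) ⟩
  coeffᶻ p k ℤ.+ coeffᶻ q k                         ≡⟨ coeffᶻ-+ p q k ⟨
  coeffᶻ (p + q) k                                  ∎

palindromic-· : ∀ {d} m p → Palindromic d p → Palindromic d (m · p)
palindromic-· {d} zero    p pal = palindromic-0 d
palindromic-· (suc m) p pal = palindromic-+ p (m · p) pal (palindromic-· m p pal)

palindromic-∑ : ∀ {d} {xs : List ℕ} {f} → All (λ i → Palindromic d (f i)) xs → Palindromic d (∑ xs f)
palindromic-∑ {d} []         = palindromic-0 d
palindromic-∑     (pal ∷ ps) = palindromic-+ _ _ pal (palindromic-∑ ps)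

palindromic-t* : ∀ {d} p → Palindromic d p → Palindromic (2 ℕ.+ d) (t * p)
palindromic-t* {d} p pal k = begin
  coeffᶻ (t * p) (+ (2 ℕ.+ d) ℤ.- k)        ≡⟨ coeffᶻ-t* p (+ (2 ℕ.+ d) ℤ.- k) ⟩
  coeffᶻ p (ℤ.pred (+ (2 ℕ.+ d) ℤ.- k))     ≡⟨ ≡.cong (coeffᶻ p) (reflect (+ d) k) ⟩
  coeffᶻ p (+ d ℤ.- ℤ.pred k)               ≡⟨ pal (ℤ.pred k) ⟩
  coeffᶻ p (ℤ.pred k)                       ≡⟨ coeffᶻ-t* p k ⟨
  coeffᶻ (t * p) k                          ∎
  where
  reflect : ∀ m k → ℤ.-1ℤ ℤ.+ ((+ 2 ℤ.+ m) ℤ.- k) ≡ m ℤ.- (ℤ.-1ℤ ℤ.+ k)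
  reflect = solve-∀

-- The reflection interchanges the contributions of the summands 1 and t of the factor.
palindromic-[1+t]* : ∀ {d} p → Palindromic d p → Palindromic (suc d) ((1ᴾ + t) * p)
palindromic-[1+t]* {d} p pal k = begin
  coeffᶻ ((1ᴾ + t) * p) k′             ≡⟨ expand k′ ⟩
  coeffᶻ p k′ ℤ.+ coeffᶻ p (ℤ.pred k′)
    ≡⟨ ≡.cong₂ (λ i j → coeffᶻ p i ℤ.+ coeffᶻ p j) (reflect₁ (+ d) k) (reflect₂ (+ d) k) ⟩
  coeffᶻ p (+ d ℤ.- ℤ.pred k) ℤ.+ coeffᶻ p (+ d ℤ.- k)
    ≡⟨ ≡.cong₂ ℤ._+_ (pal (ℤ.pred k)) (pal k) ⟩
  coeffᶻ p (ℤ.pred k) ℤ.+ coeffᶻ p k   ≡⟨ ℤ.+-comm (coeffᶻ p (ℤ.pred k)) _ ⟩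
  coeffᶻ p k ℤ.+ coeffᶻ p (ℤ.pred k)   ≡⟨ expand k ⟨
  coeffᶻ ((1ᴾ + t) * p) k              ∎
  where
  k′ = + suc d ℤ.- k

  expand : ∀ k → coeffᶻ ((1ᴾ + t) * p) k ≡ coeffᶻ p k ℤ.+ coeffᶻ p (ℤ.pred k)
  expand k = begin
    coeffᶻ ((1ᴾ + t) * p) k
      ≡⟨ coeffᶻ-cong {(1ᴾ + t) * p} (*-distribʳ-+ p 1ᴾ t) k ⟩
    coeffᶻ (1ᴾ * p + t * p) k
      ≡⟨ coeffᶻ-+ (1ᴾ * p) (t * p) k ⟩
    coeffᶻ (1ᴾ * p) k ℤ.+ coeffᶻ (t * p) k
      ≡⟨ ≡.cong₂ ℤ._+_ (coeffᶻ-cong {1ᴾ * p} (*-identityˡ p) k) (coeffᶻ-t* p k) ⟩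
    coeffᶻ p k ℤ.+ coeffᶻ p (ℤ.pred k) ∎

  reflect₁ : ∀ m k → (1ℤ ℤ.+ m) ℤ.- k ≡ m ℤ.- (ℤ.-1ℤ ℤ.+ k)
  reflect₁ = solve-∀

  reflect₂ : ∀ m k → ℤ.-1ℤ ℤ.+ ((1ℤ ℤ.+ m) ℤ.- k) ≡ m ℤ.- k
  reflect₂ = solve-∀

palindromic-[1+t]^ : ∀ j → Palindromic j ((1ᴾ + t) ^ j)
palindromic-[1+t]^ zero    = palindromic-1
palindromic-[1+t]^ (suc j) = palindromic-[1+t]* ((1ᴾ + t) ^ j) (palindromic-[1+t]^ j)

palindromic-γ : ∀ i j {d} → j ℕ.+ 2 ℕ.* i ≡ d → Palindromic d (t ^ i * (1ᴾ + t) ^ j)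
palindromic-γ zero    j ≡.refl = palindromic-cong {p = (1ᴾ + t) ^ j} (λ k → ≡.sym (*-identityˡ ((1ᴾ + t) ^ j) k))
  (≡.subst (λ d → Palindromic d ((1ᴾ + t) ^ j)) (≡.sym (ℕ.+-identityʳ j)) (palindromic-[1+t]^ j))
palindromic-γ (suc i) j ≡.refl = palindromic-cong {p = t * (t ^ i * (1ᴾ + t) ^ j)}
  (λ k → ≡.sym (*-assoc t (t ^ i) ((1ᴾ + t) ^ j) k))
  (≡.subst (λ d → Palindromic d (t * (t ^ i * (1ᴾ + t) ^ j))) (≡.sym (+2*-suc j i ≡.refl))
    (palindromic-t* (t ^ i * (1ᴾ + t) ^ j) (palindromic-γ i j ≡.refl)))

-- The symmetric decomposition given by the γ-sums

open GammaSums polyCommutativeSemiring t using (γ⁺-sum; γ⁻-sum; γ-sums)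

γ-decomposition : ∀ n → IsSymmetricDecomposition n (B̃ n) (γ⁺-sum n) (γ⁻-sum n)
γ-decomposition n = record
  { sum≈         = λ k → ≡.trans (WordSums.∑-γ-weight polyCommutativeSemiring t n k) (≡.sym (γ-sums n k))
  ; palindromic⁺ = palindromic-∑ (All.applyUpTo⁺₁ _ (suc ⌊ n /2⌋) λ { {i} (s≤s i≤) →
      palindromic-· (γ̃⁺ n i) _ (palindromic-γ i (n ∸ 2 ℕ.* i) (∸-2*-⌊/2⌋ i≤)) })
  -- The range starts at 1, so position `i` of the list carries the summand with index `suc i`.
  ; palindromic⁻ = palindromic-∑ (All.applyUpTo⁺₁ _ ⌊ suc n /2⌋ λ {i} i< →
      palindromic-· (γ̃⁻ n (suc i)) _ (palindromic-γ (suc i) (suc n ∸ 2 ℕ.* suc i) (∸-2*-⌊/2⌋ i<)))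
  }

proposition8p6 : ∀ n → .{{NonZero n}} →
    (B̃⁺ n ≈ ∑[ i ∈ [ 0 ⋯ ⌊ n /2⌋ ] ] γ̃⁺ n i · (t ^ i * (1ᴾ + t) ^ (n ∸ 2 ℕ.* i)))
    × (B̃⁻ n ≈ ∑[ i ∈ [ 1 ⋯ ⌊ suc n /2⌋ ] ] γ̃⁻ n i · (t ^ i * (1ᴾ + t) ^ (suc n ∸ 2 ℕ.* i)))
proposition8p6 n = symmetricDecomposition-unique (proj₂ (proj₂ (B̃-decomposition n))) (γ-decomposition n)
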